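{- Let $t$ be an odd prime. For every integer $n\geq 0$ such that $8n+1$ is a quadratic nonresidue modulo $t$, and every $0\leq i\leq t-1$, \[ \hat{N}_{t-1}(i,t,n)=\frac{\hat{p}_{t-1}(n)}{t}. \] In particular, $\hat{p}_{t-1}(n)\equiv 0\pmod t$.
   Context: A pod (partition with odd parts distinct) is an integer partition in which each odd part appears at most once (even parts are unrestricted). For a positive integer $s$, an $s$-colored pod of $n$ is an $s$-tuple $\vec\pi=(\pi_1,\dots,\pi_s)$ of pods with $\sum_{k=1}^s|\pi_k|=n$, where $|\pi|$ is the sum of the parts of $\pi$. Let $\ell(\pi)$ be the number of parts of $\pi$ (odd and even both counted). Let $\hat{p}_s(n)$ be the number of $s$-colored pods of $n$. For $s$ even, the multirank of $\vec\pi=(\pi_1,\dots,\pi_s)$ is $\overline{r}(\vec\pi)=\sum_{k=1}^{s/2}k\bigl(\ell(\pi_k)-\ell(\pi_{s+1-k})\bigr)$. Let $\hat{N}_s(i,t,n)$ be the number of $s$-colored pods of $n$ whose multirank $\overline{r}$ is congruent to $i$ modulo $t$. -}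

module Defs where

open import Data.Nat using (ℕ; zero; suc; _+_; _*_; _∸_; _/_; _%_; _≟_; _≤?_; NonZero)
open import Data.Integer using (ℤ; +_) renaming (_-_ to _-ℤ_; _+_ to _+ℤ_; _*_ to _*ℤ_)
open import Data.Integer.DivMod using (_%ℕ_)
open import Data.List using (List; []; _∷_; _++_; map; concatMap; upTo; replicate; filterᵇ; length; foldr)
open import Data.Vec using (Vec; []; _∷_; toList)
open import Data.Bool using (Bool; true; false; if_then_else_; _∧_)
open import Data.Product using (∃)
open import Relation.Binary.PropositionalEquality using (_≡_)
open import Relation.Nullary using (¬_; does)

-- Pods.  A partition is represented as a non-increasing list of
-- positive parts.  A pod is a partition in which each odd part occurs
-- at most once (even parts unrestricted).

isOdd : ℕ → Bool
isOdd n = does ((n % 2) ≟ 1)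

allowedMult : ℕ → ℕ → ℕ → Bool
allowedMult part n k =
  does (k * part ≤? n) ∧ (if isOdd part then does (k ≤? 1) else true)

-- podsBounded m n : the list of all pods of n all of whose parts are ≤ m
-- (each exactly once).  For the largest admissible part value (m+1) we
-- choose its multiplicity k, then recurse on parts ≤ m.
podsBounded : ℕ → ℕ → List (List ℕ)
podsBounded zero n = if does (n ≟ 0) then ([] ∷ []) else []
podsBounded (suc m) n =
  concatMap
    (λ k → map (λ rest → replicate k (suc m) ++ rest)
               (podsBounded m (n ∸ k * suc m)))
    (filterᵇ (allowedMult (suc m) n) (upTo (suc n)))

pods : ℕ → List (List ℕ)
pods n = podsBounded n n

coloredPods : (s : ℕ) → ℕ → List (Vec (List ℕ) s)
coloredPods zero n = if does (n ≟ 0) then ([] ∷ []) else []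
coloredPods (suc s) n =
  concatMap
    (λ j → concatMap (λ π → map (π ∷_) (coloredPods s (n ∸ j))) (pods j))
    (upTo (suc n))

phat : ℕ → ℕ → ℕ
phat s n = length (coloredPods s n)

-- Multirank (meaningful for s even):
--   r̄(π) = Σ_{k=1}^{s/2} k (ℓ(πₖ) − ℓ(π_{s+1−k}))
-- where ℓ(π) is the number of parts.

nth : List (List ℕ) → ℕ → List ℕ
nth []       _       = []
nth (x ∷ xs) zero    = x
nth (x ∷ xs) (suc k) = nth xs k

ℓat : ∀ {s} → Vec (List ℕ) s → ℕ → ℕ
ℓat {s} v k = length (nth (toList v) (k ∸ 1))

sumℤ : List ℤ → ℤ
sumℤ = foldr _+ℤ_ (+ 0)

multirank : ∀ {s} → Vec (List ℕ) s → ℤ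
multirank {s} v =
  sumℤ (map (λ j → let k = suc j in
                   (+ k) *ℤ ((+ ℓat v k) -ℤ (+ ℓat v ((s + 1) ∸ k))))
            (upTo (s / 2)))

Nhat : (s i t n : ℕ) → .{{NonZero t}} → ℕ
Nhat s i t n =
  length (filterᵇ (λ v → does ((multirank v %ℕ t) ≟ (i % t))) (coloredPods s n))

-- a is a quadratic nonresidue modulo t: a is not ≡ x² (mod t) for any x.
-- (In particular a ≢ 0 mod t, taking x = 0; for prime t this is exactly
-- Legendre symbol (a/t) = −1.)
QuadNonResidue : ℕ → (t : ℕ) → .{{NonZero t}} → Set
QuadNonResidue a t = ¬ (∃ λ x → (x * x) % t ≡ a % t)

{-# OPTIONS --safe #-}
-- Let ζ be a primitive t-th root of unity and let B(z) = ∏ (1 + z q^(2j-1)) / (1 - z q^(2j)) be the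
-- generating function of pods by number of parts.  Modulo t the multirank is ∑ k ℓ(π_k), so the
-- multirank generating function at ζ is A = ∏_{0<k<t} B(ζ^k).  Substituting ζ q for q permutes the
-- factors of F = ∏_{0≤k<t} B(ζ^k) = B(1) A, so F only involves powers of q^t.  By Gauss, 1 / B(1) is
-- ∑ (-q)^(m(m+1)/2), hence A = F / B(1) has non-zero coefficients only at n ≡ m(m+1)/2, that is
-- 8n + 1 ≡ (2m+1)², modulo t.  A vanishing coefficient at ζ means that all residue classes of the
-- multirank are equally frequent.
module Submission where

open import Defs
open import Algebra using (CommutativeMonoid; CommutativeRing)
open import Data.Bool using (Bool; true; false; if_then_else_)
open import Data.Integer as ℤ using (ℤ; +_; -[1+_])
open import Data.Integer.DivMod using (_%ℕ_; _/ℕ_; a≡a%ℕn+[a/ℕn]*n; n%ℕd<d)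
open import Data.Integer.Properties as ℤ using ()
open import Data.Integer.Tactic.RingSolver using () renaming (solve-∀ to solve-ℤ)
open import Data.List using (List; []; _∷_; _++_; map; concatMap; applyUpTo; upTo; filterᵇ; length; replicate)
open import Data.List.Properties using (length-++; length-replicate)
open import Data.Nat using (ℕ; zero; suc; _+_; _*_; _∸_; _/_; _%_; _≟_; _≤?_; _≤_; _<_; z≤n; s≤s; _≤′_; ≤′-refl; ≤′-step; NonZero; ≢-nonZero⁻¹)
open import Data.Nat.Coprimality using (Coprime; coprime-Bézout)
open import Data.Nat.DivMod using (m<n⇒m%n≡m; m%n<n; m*n/n≡m; m≡m%n+[m/n]*n; [m+n]%n≡m%n; [m+kn]%n≡m%n)
open import Data.Nat.Divisibility using (_∣_; divides)
open import Data.Nat.GCD using (module Bézout)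
open import Data.Nat.Primality using (Prime; prime⇒irreducible)
open import Data.Nat.Properties as ℕ using ()
open import Data.Nat.Tactic.RingSolver using (solve-∀)
open import Data.Product using (_×_; _,_)
open import Data.Sum using (inj₁; inj₂)
open import Data.Vec using (Vec; []; _∷_; toList)
open import Level using (Level)
open import Relation.Binary.PropositionalEquality as ≡ using (_≡_; _≢_)
open import Relation.Nullary using (¬_; does; yes; no; contradiction)
open import Relation.Nullary.Decidable using (dec-true; dec-false)

-- Series are taken modulo q^(N+1), where N is the degree n of the single coefficient sought. Modulo
-- q^(N+1) a part larger than N contributes the factor 1, so every infinite product becomes a finite
-- one, and 1 - x^k with k > 0 and x = -q becomes cancellable, so Gauss's identity can be drawn from
-- a finite identity of Shanks.
--
-- The coefficient ring is kept abstract. It enters through ζ^t = 1, ∑ ζ^k = 0 over 0 ≤ k < t, and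
-- the absence of t-torsion. In place of comparing coefficients over a field, ζ^m a = a is shown to
-- force a = 0 when t does not divide m: by Bézout ζ itself fixes a, hence t a = (∑ ζ^k) a = 0.
--
-- The concrete ring consists of operators on integer sequences. The passage from a vanishing sum of
-- powers of ζ to equal class sizes is then an evaluation: the operator is applied to the sequence
-- that is t - 1 on one residue class and -1 elsewhere.

-- Finite folds in a commutative monoid, serving both sums and products

module RangeFold {c ℓ : Level} (M : CommutativeMonoid c ℓ) where
  open CommutativeMonoid M
  open import Relation.Binary.Reasoning.Setoid setoid
  open import Algebra.Properties.CommutativeSemigroup commutativeSemigroup using (interchange)

  fold : ℕ → (ℕ → Carrier) → Carrier
  fold zero    f = ε
  fold (suc n) f = f 0 ∙ fold n (λ i → f (suc i))

  fold-cong< : ∀ n {f g} → (∀ i → i < n → f i ≈ g i) → fold n f ≈ fold n g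
  fold-cong< zero    f≈g = refl
  fold-cong< (suc n) f≈g = ∙-cong (f≈g 0 (s≤s z≤n)) (fold-cong< n (λ i i<n → f≈g (suc i) (s≤s i<n)))

  fold-cong : ∀ n {f g} → (∀ i → f i ≈ g i) → fold n f ≈ fold n g
  fold-cong n f≈g = fold-cong< n (λ i _ → f≈g i)

  fold-ε : ∀ n {f} → (∀ i → i < n → f i ≈ ε) → fold n f ≈ ε
  fold-ε zero    f≈ε = refl
  fold-ε (suc n) f≈ε =
    trans (∙-cong (f≈ε 0 (s≤s z≤n)) (fold-ε n (λ i i<n → f≈ε (suc i) (s≤s i<n)))) (identityˡ ε)

  fold-∙ : ∀ n f g → fold n (λ i → f i ∙ g i) ≈ fold n f ∙ fold n g
  fold-∙ zero    f g = sym (identityˡ ε)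
  fold-∙ (suc n) f g = trans (∙-congˡ (fold-∙ n _ _)) (interchange _ _ _ _)

  fold-+ : ∀ m n f → fold (m + n) f ≈ fold m f ∙ fold n (λ i → f (m + i))
  fold-+ zero    n f = sym (identityˡ _)
  fold-+ (suc m) n f = trans (∙-congˡ (fold-+ m n _)) (sym (assoc _ _ _))

  fold-last : ∀ n f → fold (suc n) f ≈ fold n f ∙ f n
  fold-last zero    f = comm _ _
  fold-last (suc n) f = trans (∙-congˡ (fold-last n _)) (sym (assoc _ _ _))

  fold-reverse : ∀ n f → fold n (λ i → f (n ∸ suc i)) ≈ fold n f
  fold-reverse zero    f = refl
  fold-reverse (suc n) f = begin
    f n ∙ fold n (λ i → f (n ∸ suc i))  ≈⟨ ∙-congˡ (fold-reverse n f) ⟩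
    f n ∙ fold n f                      ≈⟨ comm _ _ ⟩
    fold n f ∙ f n                      ≈⟨ fold-last n f ⟨
    fold (suc n) f                      ∎

  fold-extend : ∀ {m n} f → m ≤ n → (∀ i → m ≤ i → f i ≈ ε) → fold n f ≈ fold m f
  fold-extend {n = n} f z≤n f≈ε = fold-ε n (λ i _ → f≈ε i z≤n)
  fold-extend f (s≤s m≤n) f≈ε = ∙-congˡ (fold-extend _ m≤n (λ i m≤i → f≈ε (suc i) (s≤s m≤i)))

  -- Shifting by one trades the first factor `f 0` for `f n`, which periodicity identifies with it;
  -- the shifted sequence is periodic again, so the step can be repeated.
  fold-rotate : ∀ n f → (∀ i → f (n + i) ≈ f i) → ∀ j → fold n (λ i → f (i + j)) ≈ fold n f
  fold-rotate n f periodic zero    = fold-cong n (λ i → reflexive (≡.cong f (ℕ.+-identityʳ i)))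
  fold-rotate n f periodic (suc j) = begin
    fold n (λ i → f (i + suc j))        ≈⟨ fold-cong n (λ i → reflexive (≡.cong f (ℕ.+-suc i j))) ⟩
    fold n (λ i → f (suc (i + j)))      ≈⟨ fold-rotate n (λ i → f (suc i)) periodic′ j ⟩
    fold n (λ i → f (suc i))            ≈⟨ rotate n f (trans (reflexive (≡.cong f (≡.sym (ℕ.+-identityʳ n)))) (periodic 0)) ⟩
    fold n f                            ∎
    where
    periodic′ : ∀ i → f (suc (n + i)) ≈ f (suc i)
    periodic′ i = trans (reflexive (≡.cong f (≡.sym (ℕ.+-suc n i)))) (periodic (suc i))
    rotate : ∀ n f → f n ≈ f 0 → fold n (λ i → f (suc i)) ≈ fold n f
    rotate zero    f fn≈f0 = refl
    rotate (suc n) f fn≈f0 = begin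
      fold (suc n) (λ i → f (suc i))      ≈⟨ fold-last n _ ⟩
      fold n (λ i → f (suc i)) ∙ f (suc n) ≈⟨ ∙-congˡ fn≈f0 ⟩
      fold n (λ i → f (suc i)) ∙ f 0      ≈⟨ comm _ _ ⟩
      fold (suc n) f                      ∎

module RingSums {c ℓ : Level} (R : CommutativeRing c ℓ) where
  open CommutativeRing R renaming (_+_ to _⊕_; _*_ to _⊛_)
  open RangeFold +-commutativeMonoid public
    renaming ( fold to ∑; fold-cong< to ∑-cong<; fold-cong to ∑-cong; fold-ε to ∑-0; fold-∙ to ∑-+
             ; fold-+ to ∑-split; fold-last to ∑-last; fold-reverse to ∑-reverse
             ; fold-extend to ∑-extend; fold-rotate to ∑-rotate )

  ∑-distribˡ : ∀ a n f → a ⊛ ∑ n f ≈ ∑ n (λ i → a ⊛ f i)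
  ∑-distribˡ a zero    f = zeroʳ a
  ∑-distribˡ a (suc n) f = trans (distribˡ _ _ _) (+-congˡ (∑-distribˡ a n _))

  ∑-distribʳ : ∀ a n f → ∑ n f ⊛ a ≈ ∑ n (λ i → f i ⊛ a)
  ∑-distribʳ a zero    f = zeroˡ a
  ∑-distribʳ a (suc n) f = trans (distribʳ _ _ _) (+-congˡ (∑-distribʳ a n _))

-- Formal power series and their truncation

module PowerSeries {c ℓ : Level} (R : CommutativeRing c ℓ) where
  open CommutativeRing R renaming (_+_ to _⊕_; _*_ to _⊛_; -_ to ⊖_)
  open RingSums R
  open import Relation.Binary.Reasoning.Setoid setoid

  Series : Set c
  Series = ℕ → Carrier

  infixl 7 _·_
  infixl 6 _+ˢ_

  tail : Series → Series
  tail f n = f (suc n)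

  _+ˢ_ : Series → Series → Series
  (f +ˢ g) n = f n ⊕ g n

  -ˢ_ : Series → Series
  (-ˢ f) n = ⊖ f n

  0ˢ : Series
  0ˢ _ = 0#

  monomial : ℕ → Carrier → Series
  monomial zero    a zero    = a
  monomial zero    a (suc n) = 0#
  monomial (suc k) a zero    = 0#
  monomial (suc k) a (suc n) = monomial k a n

  1ˢ : Series
  1ˢ = monomial 0 1#

  _·_ : Series → Series → Series
  (f · g) n = ∑ (suc n) (λ i → f i ⊛ g (n ∸ i))

  ·-cong : ∀ n {f f′ g g′} → (∀ i → i ≤ n → f i ≈ f′ i) → (∀ i → i ≤ n → g i ≈ g′ i) →
           (f · g) n ≈ (f′ · g′) n
  ·-cong n f≈f′ g≈g′ =
    ∑-cong< (suc n) (λ { i (s≤s i≤n) → *-cong (f≈f′ i i≤n) (g≈g′ (n ∸ i) (ℕ.m∸n≤m n i)) })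

  scale-· : ∀ a f g n → ((λ i → a ⊛ f i) · g) n ≈ a ⊛ (f · g) n
  scale-· a f g n = trans (∑-cong (suc n) (λ i → *-assoc a (f i) (g (n ∸ i))))
                          (sym (∑-distribˡ a (suc n) (λ i → f i ⊛ g (n ∸ i))))

  ·-distribʳ : ∀ f g h n → ((g +ˢ h) · f) n ≈ ((g · f) +ˢ (h · f)) n
  ·-distribʳ f g h n = trans (∑-cong (suc n) (λ i → distribʳ (f (n ∸ i)) (g i) (h i)))
                             (∑-+ (suc n) (λ i → g i ⊛ f (n ∸ i)) (λ i → h i ⊛ f (n ∸ i)))

  -- The Cauchy product unfolds by definition along `f`; this is the mirror recursion along `g`.
  -- Commutativity is an induction that plays one against the other.
  ·-last : ∀ f g n → (f · g) (suc n) ≈ f (suc n) ⊛ g 0 ⊕ (f · tail g) n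
  ·-last f g zero = begin
    f 0 ⊛ g 1 ⊕ (f 1 ⊛ g 0 ⊕ 0#)  ≈⟨ +-congˡ (+-identityʳ _) ⟩
    f 0 ⊛ g 1 ⊕ f 1 ⊛ g 0         ≈⟨ +-comm _ _ ⟩
    f 1 ⊛ g 0 ⊕ f 0 ⊛ g 1         ≈⟨ +-congˡ (+-identityʳ _) ⟨
    f 1 ⊛ g 0 ⊕ (f 0 ⊛ g 1 ⊕ 0#)  ∎
  ·-last f g (suc n) = begin
    a ⊕ (tail f · g) (suc n)              ≈⟨ +-congˡ (·-last (tail f) g n) ⟩
    a ⊕ (b ⊕ (tail f · tail g) n)         ≈⟨ +-assoc _ _ _ ⟨
    (a ⊕ b) ⊕ (tail f · tail g) n         ≈⟨ +-congʳ (+-comm _ _) ⟩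
    (b ⊕ a) ⊕ (tail f · tail g) n         ≈⟨ +-assoc _ _ _ ⟩
    b ⊕ (a ⊕ (tail f · tail g) n)         ∎
    where a = f 0 ⊛ g (suc (suc n)); b = f (suc (suc n)) ⊛ g 0

  ·-comm : ∀ f g n → (f · g) n ≈ (g · f) n
  ·-comm f g zero    = +-congʳ (*-comm _ _)
  ·-comm f g (suc n) = begin
    f 0 ⊛ g (suc n) ⊕ (tail f · g) n  ≈⟨ +-cong (*-comm _ _) (·-comm (tail f) g n) ⟩
    g (suc n) ⊛ f 0 ⊕ (g · tail f) n  ≈⟨ ·-last g f n ⟨
    (g · f) (suc n)                   ∎

  ·-assoc : ∀ f g h n → ((f · g) · h) n ≈ (f · (g · h)) n
  ·-assoc f g h zero = +-congʳ (begin
    (f 0 ⊛ g 0 ⊕ 0#) ⊛ h 0    ≈⟨ *-congʳ (+-identityʳ _) ⟩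
    f 0 ⊛ g 0 ⊛ h 0           ≈⟨ *-assoc _ _ _ ⟩
    f 0 ⊛ (g 0 ⊛ h 0)         ≈⟨ *-congˡ (+-identityʳ _) ⟨
    f 0 ⊛ (g 0 ⊛ h 0 ⊕ 0#)    ∎)
  ·-assoc f g h (suc n) = begin
    (f 0 ⊛ g 0 ⊕ 0#) ⊛ h′ ⊕ (tail (f · g) · h) n
      ≈⟨ +-cong (*-congʳ (+-identityʳ _)) (·-distribʳ h (λ i → f 0 ⊛ tail g i) (tail f · g) n) ⟩
    f 0 ⊛ g 0 ⊛ h′ ⊕ (((λ i → f 0 ⊛ tail g i) · h) n ⊕ ((tail f · g) · h) n)
      ≈⟨ +-cong (*-assoc _ _ _) (+-cong (scale-· (f 0) (tail g) h n) (·-assoc (tail f) g h n)) ⟩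
    f 0 ⊛ (g 0 ⊛ h′) ⊕ (f 0 ⊛ (tail g · h) n ⊕ (tail f · (g · h)) n)
      ≈⟨ +-assoc _ _ _ ⟨
    (f 0 ⊛ (g 0 ⊛ h′) ⊕ f 0 ⊛ (tail g · h) n) ⊕ (tail f · (g · h)) n
      ≈⟨ +-congʳ (distribˡ _ _ _) ⟨
    f 0 ⊛ (g · h) (suc n) ⊕ (tail f · (g · h)) n ∎
    where h′ = h (suc n)

  shift : ℕ → Series → Series
  shift zero    f n       = f n
  shift (suc k) f zero    = 0#
  shift (suc k) f (suc n) = shift k f n

  shift-≤ : ∀ {k n} f → k ≤ n → shift k f n ≈ f (n ∸ k)
  shift-≤ f z≤n       = refl
  shift-≤ f (s≤s k≤n) = shift-≤ f k≤n

  shift-> : ∀ {k n} f → n < k → shift k f n ≈ 0#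
  shift-> {suc k} {zero}  f _         = refl
  shift-> {suc k} {suc n} f (s≤s n<k) = shift-> f n<k

  monomial-· : ∀ k a f n → (monomial k a · f) n ≈ a ⊛ shift k f n
  monomial-· zero    a f n       =
    trans (+-congˡ (∑-0 n (λ i _ → zeroˡ _))) (+-identityʳ _)
  monomial-· (suc k) a f zero    = trans (+-identityʳ _) (trans (zeroˡ _) (sym (zeroʳ _)))
  monomial-· (suc k) a f (suc n) =
    trans (+-congʳ (zeroˡ _)) (trans (+-identityˡ _) (monomial-· k a f n))

  monomial-> : ∀ {k n} a → n < k → monomial k a n ≈ 0#
  monomial-> {suc k} {zero}  a _         = refl
  monomial-> {suc k} {suc n} a (s≤s n<k) = monomial-> a n<k

  monomial-cong : ∀ {k l a b} → k ≡ l → a ≈ b → ∀ n → monomial k a n ≈ monomial l b n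
  monomial-cong {zero}  ≡.refl a≈b zero    = a≈b
  monomial-cong {zero}  ≡.refl a≈b (suc n) = refl
  monomial-cong {suc k} ≡.refl a≈b zero    = refl
  monomial-cong {suc k} ≡.refl a≈b (suc n) = monomial-cong {k} ≡.refl a≈b n

  monomial-0 : ∀ k n → monomial k 0# n ≈ 0#
  monomial-0 zero    zero    = refl
  monomial-0 zero    (suc n) = refl
  monomial-0 (suc k) zero    = refl
  monomial-0 (suc k) (suc n) = monomial-0 k n

  monomial-*-monomial : ∀ k l a b n → (monomial k a · monomial l b) n ≈ monomial (k + l) (a ⊛ b) n
  monomial-*-monomial k l a b n = trans (monomial-· k a _ n) (shift-monomial k l n)
    where
    scale-monomial : ∀ l n → a ⊛ monomial l b n ≈ monomial l (a ⊛ b) n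
    scale-monomial zero    zero    = refl
    scale-monomial zero    (suc n) = zeroʳ _
    scale-monomial (suc l) zero    = zeroʳ _
    scale-monomial (suc l) (suc n) = scale-monomial l n
    shift-monomial : ∀ k l n → a ⊛ shift k (monomial l b) n ≈ monomial (k + l) (a ⊛ b) n
    shift-monomial zero    l n       = scale-monomial l n
    shift-monomial (suc k) l zero    = zeroʳ _
    shift-monomial (suc k) l (suc n) = shift-monomial k l n

  ·-identityˡ : ∀ f n → (1ˢ · f) n ≈ f n
  ·-identityˡ f n = trans (monomial-· 0 1# f n) (*-identityˡ _)

module Truncated {c ℓ : Level} (R : CommutativeRing c ℓ) (N : ℕ) where
  open CommutativeRing R
  open PowerSeries R

  infix 4 _≋_

  -- Equality in R[q]/(q^(N+1)). Sequences stay infinite and only equality is weakened, so that no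
  -- operation has to truncate; multiplication respects it because the coefficient n of a product
  -- involves only coefficients up to n.
  record _≋_ (f g : Series) : Set ℓ where
    constructor coefficientwise
    field
      at : ∀ n → n ≤ N → f n ≈ g n

  open _≋_ public

  pointwise : ∀ {f g} → (∀ n → f n ≈ g n) → f ≋ g
  pointwise f≈g = coefficientwise (λ n _ → f≈g n)

  seriesRing : CommutativeRing c ℓ
  seriesRing = record
    { Carrier = Series
    ; _≈_ = _≋_
    ; _+_ = _+ˢ_
    ; _*_ = _·_
    ; -_  = -ˢ_
    ; 0#  = 0ˢ
    ; 1#  = 1ˢ
    ; isCommutativeRing = record
      { isRing = record
        { +-isAbelianGroup = record
          { isGroup = record
            { isMonoid = record
              { isSemigroup = record
                { isMagma = record
                  { isEquivalence = record
                    { refl  = pointwise (λ _ → refl)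
                    ; sym   = λ p → coefficientwise (λ n n≤N → sym (at p n n≤N))
                    ; trans = λ p q → coefficientwise (λ n n≤N → trans (at p n n≤N) (at q n n≤N))
                    }
                  ; ∙-cong = λ p q → coefficientwise (λ n n≤N → +-cong (at p n n≤N) (at q n n≤N))
                  }
                ; assoc = λ f g h → pointwise (λ n → +-assoc _ _ _)
                }
              ; identity = (λ f → pointwise (λ n → +-identityˡ _)) , (λ f → pointwise (λ n → +-identityʳ _))
              }
            ; inverse = (λ f → pointwise (λ n → -‿inverseˡ _)) , (λ f → pointwise (λ n → -‿inverseʳ _))
            ; ⁻¹-cong = λ p → coefficientwise (λ n n≤N → -‿cong (at p n n≤N))
            }
          ; comm = λ f g → pointwise (λ n → +-comm _ _)
          }
        ; *-cong = λ p q → coefficientwise (λ n n≤N →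
            ·-cong n (λ i i≤n → at p i (ℕ.≤-trans i≤n n≤N)) (λ i i≤n → at q i (ℕ.≤-trans i≤n n≤N)))
        ; *-assoc = λ f g h → pointwise (·-assoc f g h)
        ; *-identity = (λ f → pointwise (·-identityˡ f))
                     , (λ f → pointwise (λ n → trans (·-comm f 1ˢ n) (·-identityˡ f n)))
        ; distrib = (λ f g h → pointwise (λ n → trans (·-comm f (g +ˢ h) n) (trans (·-distribʳ f g h n)
                                                  (+-cong (·-comm g f n) (·-comm h f n)))))
                  , (λ f g h → pointwise (·-distribʳ f g h))
        }
      ; *-comm = λ f g → pointwise (·-comm f g)
      }
    }

-- Gauss's identity for triangular numbers, from Shanks' finite form

-- Equations are arranged so that no subtraction occurs: y + w z ≈ z + w y stands for
-- (1 - w) y ≈ (1 - w) z.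
module GaussIdentity {c ℓ : Level} (A : CommutativeRing c ℓ) where
  open CommutativeRing A renaming (_+_ to _⊕_; _*_ to _⊛_; -_ to ⊖_)
  open RingSums A
  open import Algebra.Properties.CommutativeSemiring.Exp commutativeSemiring
  open import Algebra.Properties.Group +-group using (∙-cancelʳ)
  open import Algebra.Solver.Ring.NaturalCoefficients.Default commutativeSemiring using (solve; _:+_; _:*_; _:=_)
  open import Relation.Binary.Reasoning.Setoid setoid

  module _ (x : Carrier) (N : ℕ) (x^[1+N]≈0 : x ^ suc N ≈ 0#) where

    x^n≈0 : ∀ {n} → N < n → x ^ n ≈ 0#
    x^n≈0 {n} N<n = begin
      x ^ n                        ≡⟨ ≡.cong (x ^_) (ℕ.m+[n∸m]≡n N<n) ⟨
      x ^ (suc N + (n ∸ suc N))    ≈⟨ ^-homo-* x (suc N) (n ∸ suc N) ⟩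
      x ^ suc N ⊛ x ^ (n ∸ suc N)  ≈⟨ *-congʳ x^[1+N]≈0 ⟩
      0# ⊛ x ^ (n ∸ suc N)         ≈⟨ zeroˡ _ ⟩
      0#                           ∎

    -- With w = x^(n+1) the hypothesis says (1 - w)(y - z) = 0. It propagates to (1 - w^k)(y - z) =
    -- 0 for every k, and w^(N+1) = 0 by nilpotency of x.
    [1-x^n]-cancel : ∀ n {y z} → y ⊕ x ^ suc n ⊛ z ≈ z ⊕ x ^ suc n ⊛ y → y ≈ z
    [1-x^n]-cancel n {y} {z} eq = begin
      y                ≈⟨ +-identityʳ y ⟨
      y ⊕ 0#           ≈⟨ +-congˡ (vanish z) ⟨
      y ⊕ w ^ suc N ⊛ z  ≈⟨ iterate (suc N) ⟩
      z ⊕ w ^ suc N ⊛ y  ≈⟨ +-congˡ (vanish y) ⟩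
      z ⊕ 0#           ≈⟨ +-identityʳ z ⟩
      z                ∎
      where
      w = x ^ suc n
      vanish : ∀ a → w ^ suc N ⊛ a ≈ 0#
      vanish a =
        trans (*-congʳ (trans (^-assocʳ x (suc n) (suc N)) (x^n≈0 (ℕ.m≤n*m (suc N) (suc n))))) (zeroˡ a)
      iterate : ∀ k → y ⊕ w ^ k ⊛ z ≈ z ⊕ w ^ k ⊛ y
      iterate zero    = trans (+-cong (sym (*-identityˡ y)) (*-identityˡ z)) (+-comm _ _)
      iterate (suc k) = ∙-cancelʳ (w ⊛ y ⊕ w ⊛ z) _ _ (begin
        y ⊕ w ⊛ w ^ k ⊛ z ⊕ (w ⊛ y ⊕ w ⊛ z)
          ≈⟨ solve 4 (λ y z w v → y :+ w :* v :* z :+ (w :* y :+ w :* z) :=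
                                  y :+ w :* z :+ w :* (y :+ v :* z)) refl y z w (w ^ k) ⟩
        y ⊕ w ⊛ z ⊕ w ⊛ (y ⊕ w ^ k ⊛ z)
          ≈⟨ +-cong eq (*-congˡ (iterate k)) ⟩
        z ⊕ w ⊛ y ⊕ w ⊛ (z ⊕ w ^ k ⊛ y)
          ≈⟨ solve 4 (λ y z w v → z :+ w :* y :+ w :* (z :+ v :* y) :=
                                  z :+ w :* v :* y :+ (w :* y :+ w :* z)) refl y z w (w ^ k) ⟩
        z ⊕ w ⊛ w ^ k ⊛ y ⊕ (w ⊛ y ⊕ w ⊛ z) ∎)

    module _ (b : ℕ → Carrier) (b₀ : b 0 ≈ 1#)
             (b-step : ∀ s → b (suc s) ⊕ x ^ (1 + s * 2) ⊛ b s ≈ b s ⊕ x ^ (2 + s * 2) ⊛ b (suc s)) where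

      -- The sum of x^(m(m+1)/2) over m < 2n, with m = 2s and m = 2s + 1 taken together.
      triangularSum : ℕ → Carrier
      triangularSum n = ∑ n (λ s → x ^ (s * (1 + s * 2)) ⊕ x ^ (suc s * (1 + s * 2)))

      -- With b s = 1 / P_s, P_s = ∏_{k≤s} (1 - x^(2k)) / (1 - x^(2k-1)), the equation for m = n below is
      -- Shanks' finite form of Gauss's identity divided by P_n; its terms with s > 0 die modulo x^(N+1).
      shanksSum : ℕ → ℕ → Carrier
      shanksSum n m = ∑ m (λ s → b s ⊛ x ^ (s * (1 + n * 2)))

      -- Put G(s) = b_s x^(s(2n+1)) (1 - x^(2s)). The summand for s of (1 - x^(2n+2))
      -- `shanksSum (suc n)` - (1 - x^(2n+1)) `shanksSum n` equals G(s+1) - G(s), by `b-step`. As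
      -- G(0) = 0, only the boundary term G(m) remains.
      shanks-telescope : ∀ n m →
        shanksSum (suc n) m ⊕ x ^ (1 + n * 2) ⊛ shanksSum n m ⊕ b m ⊛ x ^ (m * (1 + n * 2)) ⊛ x ^ (m * 2) ≈
        shanksSum n m ⊕ x ^ (2 + n * 2) ⊛ shanksSum (suc n) m ⊕ b m ⊛ x ^ (m * (1 + n * 2))
      shanks-telescope n zero = +-cong (+-congˡ (trans (zeroʳ _) (sym (zeroʳ _)))) (*-identityʳ _)
      shanks-telescope n (suc m) = begin
        shanksSum (suc n) (suc m) ⊕ Z ⊛ shanksSum n (suc m) ⊕ b′ ⊛ x ^ (suc m * (1 + n * 2)) ⊛ X
          ≈⟨ +-cong (+-cong last-V′ (*-congˡ last-V)) (*-congʳ (*-congˡ x^suc-m)) ⟩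
        V′ ⊕ b m ⊛ (P ⊛ Y) ⊕ Z ⊛ (V ⊕ b m ⊛ P) ⊕ b′ ⊛ (Z ⊛ P) ⊛ X
          ≈⟨ solve 8 (λ v′ v b b′ p x y z →
               v′ :+ b :* (p :* y) :+ z :* (v :+ b :* p) :+ b′ :* (z :* p) :* x :=
               (v′ :+ z :* v :+ b :* p :* y) :+ z :* p :* (b :+ x :* b′)) refl V′ V (b m) b′ P X Y Z ⟩
        (V′ ⊕ Z ⊛ V ⊕ b m ⊛ P ⊛ Y) ⊕ Z ⊛ P ⊛ (b m ⊕ X ⊛ b′)
          ≈⟨ +-cong (shanks-telescope n m) (*-congˡ (sym (b-step m))) ⟩
        (V ⊕ x ⊛ Z ⊛ V′ ⊕ b m ⊛ P) ⊕ Z ⊛ P ⊛ (b′ ⊕ x ⊛ Y ⊛ b m)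
          ≈⟨ solve 8 (λ v′ v b b′ p x y z →
               (v :+ x :* z :* v′ :+ b :* p) :+ z :* p :* (b′ :+ x :* y :* b) :=
               (v :+ b :* p) :+ x :* z :* (v′ :+ b :* (p :* y)) :+ b′ :* (z :* p)) refl V′ V (b m) b′ P x Y Z ⟩
        (V ⊕ b m ⊛ P) ⊕ x ⊛ Z ⊛ (V′ ⊕ b m ⊛ (P ⊛ Y)) ⊕ b′ ⊛ (Z ⊛ P)
          ≈⟨ +-cong (+-cong last-V (*-congˡ last-V′)) (*-congˡ x^suc-m) ⟨
        shanksSum n (suc m) ⊕ x ⊛ Z ⊛ shanksSum (suc n) (suc m) ⊕ b′ ⊛ x ^ (suc m * (1 + n * 2)) ∎
        where
        V = shanksSum n m
        V′ = shanksSum (suc n) m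
        b′ = b (suc m)
        Z = x ^ (1 + n * 2)
        P = x ^ (m * (1 + n * 2))
        Y = x ^ (m * 2)
        X = x ^ (2 + m * 2)
        exponent : ∀ m n → m * (3 + n * 2) ≡ m * (1 + n * 2) + m * 2
        exponent = solve-∀
        last-V : shanksSum n (suc m) ≈ V ⊕ b m ⊛ P
        last-V = ∑-last m _
        last-V′ : shanksSum (suc n) (suc m) ≈ V′ ⊕ b m ⊛ (P ⊛ Y)
        last-V′ = trans (∑-last m _) (+-congˡ (*-congˡ
          (trans (^-congʳ x (exponent m n)) (^-homo-* x (m * (1 + n * 2)) (m * 2)))))
        x^suc-m : x ^ (suc m * (1 + n * 2)) ≈ Z ⊛ P
        x^suc-m = ^-homo-* x (1 + n * 2) _

      shanks : ∀ n → b n ⊛ triangularSum n ≈ shanksSum n n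
      shanks zero    = zeroʳ _
      -- The telescope is taken at m = n + 1. The additional summand of `shanksSum n` supplies the
      -- triangular power `P`, the boundary term supplies `Q`. Since (1 - Z) b_n = (1 - X) b_(n+1),
      -- both sides acquire the factor 1 - X, which cancels. `C` is what both sides receive so that
      -- no subtraction occurs.
      shanks (suc n) = [1-x^n]-cancel (1 + n * 2) (∙-cancelʳ C _ _ (begin
        b′ ⊛ triangularSum (suc n) ⊕ X ⊛ V′ ⊕ C
          ≈⟨ +-congʳ (+-congʳ (*-congˡ last-Θ)) ⟩
        b′ ⊛ (Θ ⊕ (P ⊕ Q)) ⊕ X ⊛ V′ ⊕ (shanksSum n (suc n) ⊕ b′ ⊛ Q ⊕ Z ⊛ (b n ⊛ (Θ ⊕ (P ⊕ Q))))
          ≈⟨ solve 9 (λ b′ θ x v′ w q z b p →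
               b′ :* (θ :+ (p :+ q)) :+ x :* v′ :+ (w :+ b′ :* q :+ z :* (b :* (θ :+ (p :+ q)))) :=
               (b′ :+ z :* b) :* (θ :+ (p :+ q)) :+ (w :+ x :* v′ :+ b′ :* q))
               refl b′ Θ X V′ (shanksSum n (suc n)) Q Z (b n) P ⟩
        (b′ ⊕ Z ⊛ b n) ⊛ (Θ ⊕ (P ⊕ Q)) ⊕ (shanksSum n (suc n) ⊕ X ⊛ V′ ⊕ b′ ⊛ Q)
          ≈⟨ +-cong (*-congʳ (b-step n)) (sym (shanks-telescope n (suc n))) ⟩
        (b n ⊕ X ⊛ b′) ⊛ (Θ ⊕ (P ⊕ Q)) ⊕ (V′ ⊕ Z ⊛ shanksSum n (suc n) ⊕ b′ ⊛ Q ⊛ X)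
          ≈⟨ +-congˡ (+-congʳ (+-congˡ (*-congˡ last-V))) ⟩
        (b n ⊕ X ⊛ b′) ⊛ (Θ ⊕ (P ⊕ Q)) ⊕ (V′ ⊕ Z ⊛ (b n ⊛ Θ ⊕ b n ⊛ P) ⊕ b′ ⊛ Q ⊛ X)
          ≈⟨ solve 8 (λ b′ θ x v′ q z b p →
               (b :+ x :* b′) :* (θ :+ (p :+ q)) :+ (v′ :+ z :* (b :* θ :+ b :* p) :+ b′ :* q :* x) :=
               v′ :+ x :* (b′ :* (θ :+ (p :+ q))) :+ ((b :* θ :+ b :* p) :+ (b :+ x :* b′) :* q :+ z :* (b :* (θ :+ p))))
               refl b′ Θ X V′ Q Z (b n) P ⟩
        V′ ⊕ X ⊛ (b′ ⊛ (Θ ⊕ (P ⊕ Q))) ⊕ ((b n ⊛ Θ ⊕ b n ⊛ P) ⊕ (b n ⊕ X ⊛ b′) ⊛ Q ⊕ Z ⊛ (b n ⊛ (Θ ⊕ P)))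
          ≈⟨ +-congˡ (+-congʳ (+-congˡ (*-congʳ (sym (b-step n))))) ⟩
        V′ ⊕ X ⊛ (b′ ⊛ (Θ ⊕ (P ⊕ Q))) ⊕ ((b n ⊛ Θ ⊕ b n ⊛ P) ⊕ (b′ ⊕ Z ⊛ b n) ⊛ Q ⊕ Z ⊛ (b n ⊛ (Θ ⊕ P)))
          ≈⟨ solve 9 (λ b′ θ x v′ w q z b p →
               v′ :+ x :* (b′ :* (θ :+ (p :+ q))) :+ (w :+ (b′ :+ z :* b) :* q :+ z :* (b :* (θ :+ p))) :=
               v′ :+ x :* (b′ :* (θ :+ (p :+ q))) :+ (w :+ b′ :* q :+ z :* (b :* (θ :+ (p :+ q)))))
               refl b′ Θ X V′ (b n ⊛ Θ ⊕ b n ⊛ P) Q Z (b n) P ⟩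
        V′ ⊕ X ⊛ (b′ ⊛ (Θ ⊕ (P ⊕ Q))) ⊕ ((b n ⊛ Θ ⊕ b n ⊛ P) ⊕ b′ ⊛ Q ⊕ Z ⊛ (b n ⊛ (Θ ⊕ (P ⊕ Q))))
          ≈⟨ +-cong (+-congˡ (*-congˡ (*-congˡ last-Θ))) (+-congʳ (+-congʳ last-V)) ⟨
        V′ ⊕ X ⊛ (b′ ⊛ triangularSum (suc n)) ⊕ C ∎))
        where
        Z = x ^ (1 + n * 2)
        P = x ^ (n * (1 + n * 2))
        Q = x ^ (suc n * (1 + n * 2))
        X = x ^ (2 + n * 2)
        b′ = b (suc n)
        Θ = triangularSum n
        V′ = shanksSum (suc n) (suc n)
        C = shanksSum n (suc n) ⊕ b′ ⊛ Q ⊕ Z ⊛ (b n ⊛ (Θ ⊕ (P ⊕ Q)))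
        last-Θ : triangularSum (suc n) ≈ Θ ⊕ (P ⊕ Q)
        last-Θ = ∑-last n _
        last-V : shanksSum n (suc n) ≈ b n ⊛ Θ ⊕ b n ⊛ P
        last-V = trans (∑-last n _) (+-congʳ (sym (shanks n)))

      gauss : b (suc N) ⊛ triangularSum (suc N) ≈ 1#
      gauss = begin
        b (suc N) ⊛ triangularSum (suc N)
          ≈⟨ shanks (suc N) ⟩
        b 0 ⊛ 1# ⊕ ∑ N (λ s → b (suc s) ⊛ x ^ (suc s * (1 + suc N * 2)))
          ≈⟨ +-cong (trans (*-identityʳ _) b₀) (∑-0 N (λ s _ → trans (*-congˡ (x^n≈0 (large s))) (zeroʳ _))) ⟩
        1# ⊕ 0#
          ≈⟨ +-identityʳ _ ⟩
        1# ∎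
        where
        large : ∀ s → N < suc s * (1 + suc N * 2)
        large s = ℕ.≤-trans (ℕ.≤-trans (ℕ.m≤m*n (suc N) 2) (ℕ.n≤1+n _)) (ℕ.m≤n*m (1 + suc N * 2) (suc s))

-- Weighted sums over lists

module ListSums {c ℓ : Level} (R : CommutativeRing c ℓ) where
  open CommutativeRing R renaming (_+_ to _⊕_; _*_ to _⊛_)
  open RingSums R

  ∑ᴸ : {A : Set} → (A → Carrier) → List A → Carrier
  ∑ᴸ w []       = 0#
  ∑ᴸ w (x ∷ xs) = w x ⊕ ∑ᴸ w xs

  ∑ᴸ-cong : ∀ {A : Set} {w w′ : A → Carrier} → (∀ x → w x ≈ w′ x) → ∀ xs → ∑ᴸ w xs ≈ ∑ᴸ w′ xs
  ∑ᴸ-cong eq []       = refl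
  ∑ᴸ-cong eq (x ∷ xs) = +-cong (eq x) (∑ᴸ-cong eq xs)

  ∑ᴸ-++ : ∀ {A : Set} (w : A → Carrier) xs ys → ∑ᴸ w (xs ++ ys) ≈ ∑ᴸ w xs ⊕ ∑ᴸ w ys
  ∑ᴸ-++ w []       ys = sym (+-identityˡ _)
  ∑ᴸ-++ w (x ∷ xs) ys = trans (+-congˡ (∑ᴸ-++ w xs ys)) (sym (+-assoc _ _ _))

  ∑ᴸ-map : ∀ {A B : Set} (w : B → Carrier) (f : A → B) xs → ∑ᴸ w (map f xs) ≈ ∑ᴸ (λ x → w (f x)) xs
  ∑ᴸ-map w f []       = refl
  ∑ᴸ-map w f (x ∷ xs) = +-congˡ (∑ᴸ-map w f xs)

  ∑ᴸ-distribˡ : ∀ {A : Set} r (w : A → Carrier) xs → ∑ᴸ (λ x → r ⊛ w x) xs ≈ r ⊛ ∑ᴸ w xs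
  ∑ᴸ-distribˡ r w []       = sym (zeroʳ r)
  ∑ᴸ-distribˡ r w (x ∷ xs) = trans (+-congˡ (∑ᴸ-distribˡ r w xs)) (sym (distribˡ _ _ _))

  ∑ᴸ-distribʳ : ∀ {A : Set} r (w : A → Carrier) xs → ∑ᴸ (λ x → w x ⊛ r) xs ≈ ∑ᴸ w xs ⊛ r
  ∑ᴸ-distribʳ r w []       = sym (zeroˡ r)
  ∑ᴸ-distribʳ r w (x ∷ xs) = trans (+-congˡ (∑ᴸ-distribʳ r w xs)) (sym (distribʳ _ _ _))

  ∑ᴸ-concatMap : ∀ {A B : Set} (w : B → Carrier) (f : A → List B) xs →
                 ∑ᴸ w (concatMap f xs) ≈ ∑ᴸ (λ x → ∑ᴸ w (f x)) xs
  ∑ᴸ-concatMap w f []       = refl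
  ∑ᴸ-concatMap w f (x ∷ xs) = trans (∑ᴸ-++ w (f x) (concatMap f xs)) (+-congˡ (∑ᴸ-concatMap w f xs))

  ∑ᴸ-filterᵇ : ∀ {A : Set} (w : A → Carrier) p xs →
               ∑ᴸ w (filterᵇ p xs) ≈ ∑ᴸ (λ x → if p x then w x else 0#) xs
  ∑ᴸ-filterᵇ w p []       = refl
  ∑ᴸ-filterᵇ w p (x ∷ xs) with p x
  ... | true  = +-congˡ (∑ᴸ-filterᵇ w p xs)
  ... | false = trans (∑ᴸ-filterᵇ w p xs) (sym (+-identityˡ _))

  ∑ᴸ-applyUpTo : ∀ {A : Set} (w : A → Carrier) f n → ∑ᴸ w (applyUpTo f n) ≈ ∑ n (λ i → w (f i))
  ∑ᴸ-applyUpTo w f zero    = refl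
  ∑ᴸ-applyUpTo w f (suc n) = +-congˡ (∑ᴸ-applyUpTo w (λ i → f (suc i)) n)

-- Generating functions of pods by number of parts

module PodSeries {c ℓ : Level} (R : CommutativeRing c ℓ) (N : ℕ) where
  open CommutativeRing R renaming (_+_ to _⊕_; _*_ to _⊛_)
  open RingSums R
  open ListSums R
  open PowerSeries R
  open Truncated R N
  module S = CommutativeRing seriesRing
  module SΣ = RingSums seriesRing
  open import Algebra.Properties.CommutativeSemiring.Exp commutativeSemiring
  open import Relation.Binary.Reasoning.Setoid setoid

  SΣ-coefficient : ∀ m (f : ℕ → Series) n → SΣ.∑ m f n ≡ ∑ m (λ i → f i n)
  SΣ-coefficient zero    f n = ≡.refl
  SΣ-coefficient (suc m) f n = ≡.cong (f 0 n ⊕_) (SΣ-coefficient m (λ i → f (suc i)) n)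

  podSeries : Carrier → ℕ → Series
  podSeries z m n = ∑ᴸ (λ π → z ^ length π) (podsBounded m n)

  podSeries-0 : ∀ z → podSeries z 0 ≋ 1ˢ
  podSeries-0 z = pointwise coefficient
    where
    coefficient : ∀ n → podSeries z 0 n ≈ 1ˢ n
    coefficient zero    = +-identityʳ _
    coefficient (suc n) = refl

  admissible : ℕ → ℕ → Bool
  admissible j k = if isOdd j then does (k ≤? 1) else true

  weight : ℕ → Carrier → ℕ → Carrier
  weight j z k = if admissible j k then z ^ k else 0#

  -- 1 + z q^j for odd j and the geometric series of z q^j for even j; the summands with
  -- k > N vanish modulo q^(N+1), and the spare one k = N + 1 keeps k = 1 in range when N = 0.
  partSeries : Carrier → ℕ → Series
  partSeries z j = SΣ.∑ (2 + N) (λ k → monomial (k * j) (weight j z k))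

  -- A pod splits into the copies of its largest admissible part and the rest. The size restriction
  -- in `allowedMult` corresponds to `shift`, which vanishes when k copies exceed n; the parity
  -- restriction is the one in `weight`.
  podSeries-suc : ∀ z m → podSeries z (suc m) ≋ partSeries z (suc m) · podSeries z m
  podSeries-suc z m = coefficientwise λ n n≤N → let open AtCoefficient n n≤N in coefficient
    where
    module AtCoefficient (n : ℕ) (n≤N : n ≤ N) where
      j = suc m
      B = podSeries z m
      with-multiplicity : ℕ → List (List ℕ)
      with-multiplicity k = map (λ rest → replicate k j ++ rest) (podsBounded m (n ∸ k * j))
      length-prefix : ∀ k (π : List ℕ) → length (replicate k j ++ π) ≡ k + length π
      length-prefix k π = ≡.trans (length-++ (replicate k j)) (≡.cong (_+ length π) (length-replicate k))
      multiplicity-sum : ∀ k → ∑ᴸ (λ π → z ^ length π) (with-multiplicity k) ≈ z ^ k ⊛ B (n ∸ k * j)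
      multiplicity-sum k = begin
        ∑ᴸ (λ π → z ^ length π) (with-multiplicity k)
          ≈⟨ ∑ᴸ-map _ _ (podsBounded m (n ∸ k * j)) ⟩
        ∑ᴸ (λ π → z ^ length (replicate k j ++ π)) (podsBounded m (n ∸ k * j))
          ≈⟨ ∑ᴸ-cong (λ π → trans (^-congʳ z (length-prefix k π)) (^-homo-* z k (length π))) (podsBounded m (n ∸ k * j)) ⟩
        ∑ᴸ (λ π → z ^ k ⊛ z ^ length π) (podsBounded m (n ∸ k * j))
          ≈⟨ ∑ᴸ-distribˡ (z ^ k) _ (podsBounded m (n ∸ k * j)) ⟩
        z ^ k ⊛ B (n ∸ k * j) ∎
      term : ∀ k → (if allowedMult j n k then ∑ᴸ (λ π → z ^ length π) (with-multiplicity k) else 0#) ≈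
                   weight j z k ⊛ shift (k * j) B n
      term k with k * j ≤? n
      ... | no kj≰n  rewrite dec-false (k * j ≤? n) kj≰n = sym (trans (*-congˡ (shift-> B (ℕ.≰⇒> kj≰n))) (zeroʳ _))
      ... | yes kj≤n rewrite dec-true (k * j ≤? n) kj≤n with admissible j k
      ...   | true  = trans (multiplicity-sum k) (*-congˡ (sym (shift-≤ B kj≤n)))
      ...   | false = sym (zeroˡ _)
      -- Since k (m+1) ≥ k, multiplicities above n miss the coefficient n. The range can therefore
      -- be lengthened to the one of `partSeries`, which does not depend on n.
      beyond : ∀ k → suc n ≤ k → weight j z k ⊛ shift (k * j) B n ≈ 0#
      beyond k n<k = trans (*-congˡ (shift-> B (ℕ.≤-trans n<k (ℕ.m≤m*n k j)))) (zeroʳ _)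
      coefficient : podSeries z j n ≈ (partSeries z j · B) n
      coefficient = begin
        podSeries z j n
          ≈⟨ ∑ᴸ-concatMap _ with-multiplicity (filterᵇ (allowedMult j n) (upTo (suc n))) ⟩
        ∑ᴸ (λ k → ∑ᴸ (λ π → z ^ length π) (with-multiplicity k)) (filterᵇ (allowedMult j n) (upTo (suc n)))
          ≈⟨ ∑ᴸ-filterᵇ _ (allowedMult j n) (upTo (suc n)) ⟩
        ∑ᴸ (λ k → if allowedMult j n k then ∑ᴸ (λ π → z ^ length π) (with-multiplicity k) else 0#) (upTo (suc n))
          ≈⟨ ∑ᴸ-applyUpTo _ (λ k → k) (suc n) ⟩
        ∑ (suc n) (λ k → if allowedMult j n k then ∑ᴸ (λ π → z ^ length π) (with-multiplicity k) else 0#)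
          ≈⟨ ∑-cong (suc n) term ⟩
        ∑ (suc n) (λ k → weight j z k ⊛ shift (k * j) B n)
          ≈⟨ ∑-extend _ (s≤s (ℕ.m≤n⇒m≤1+n n≤N)) beyond ⟨
        ∑ (2 + N) (λ k → weight j z k ⊛ shift (k * j) B n)
          ≈⟨ ∑-cong (2 + N) (λ k → monomial-· (k * j) (weight j z k) B n) ⟨
        ∑ (2 + N) (λ k → (monomial (k * j) (weight j z k) · B) n)
          ≡⟨ SΣ-coefficient (2 + N) (λ k → monomial (k * j) (weight j z k) · B) n ⟨
        SΣ.∑ (2 + N) (λ k → monomial (k * j) (weight j z k) · B) n
          ≈⟨ at (SΣ.∑-distribʳ B (2 + N) (λ k → monomial (k * j) (weight j z k))) n n≤N ⟨
        (partSeries z j · B) n ∎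

  -- A part larger than n contributes to coefficients up to n only with multiplicity 0. This
  -- replaces the bound in `pods n`, which varies with the coefficient, by a common one, as a
  -- product of series requires.
  podSeries-stable : ∀ z {m n} → n ≤ N → n ≤ m → podSeries z m n ≈ podSeries z n n
  podSeries-stable z {m} {n} n≤N n≤m = stable (ℕ.≤⇒≤′ n≤m)
    where
    stable : ∀ {m} → n ≤′ m → podSeries z m n ≈ podSeries z n n
    stable ≤′-refl = refl
    stable (≤′-step {m} n≤m) = begin
      podSeries z (suc m) n
        ≈⟨ at (podSeries-suc z m) n n≤N ⟩
      (partSeries z (suc m) · podSeries z m) n
        ≈⟨ ·-cong n {g = podSeries z m} first-term (λ _ _ → refl) ⟩
      (1ˢ · podSeries z m) n
        ≈⟨ ·-identityˡ (podSeries z m) n ⟩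
      podSeries z m n
        ≈⟨ stable n≤m ⟩
      podSeries z n n ∎
      where
      weight-0 : ∀ j → weight j z 0 ≈ 1#
      weight-0 j with isOdd j
      ... | true  = refl
      ... | false = refl
      first-term : ∀ i → i ≤ n → partSeries z (suc m) i ≈ 1ˢ i
      first-term i i≤n = begin
        partSeries z (suc m) i
          ≡⟨ SΣ-coefficient (2 + N) (λ k → monomial (k * suc m) (weight (suc m) z k)) i ⟩
        monomial 0 (weight (suc m) z 0) i ⊕ ∑ (1 + N) (λ k → monomial (suc k * suc m) (weight (suc m) z (suc k)) i)
          ≈⟨ +-cong (monomial-cong {0} ≡.refl (weight-0 (suc m)) i)
                    (∑-0 (1 + N) (λ k _ → monomial-> (weight (suc m) z (suc k))
                      (ℕ.≤-trans (s≤s (ℕ.≤-trans i≤n (ℕ.≤′⇒≤ n≤m))) (ℕ.m≤n*m (suc m) (suc k))))) ⟩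
        1ˢ i ⊕ 0#
          ≈⟨ +-identityʳ _ ⟩
        1ˢ i ∎

-- The pod series at z = 1 as the reciprocal of a theta series

isOdd-odd : ∀ s → isOdd (1 + s * 2) ≡ true
isOdd-odd s = ≡.cong (λ r → does (r ≟ 1)) ([m+kn]%n≡m%n 1 s 2)

isOdd-even : ∀ s → isOdd (s * 2) ≡ false
isOdd-even s = ≡.cong (λ r → does (r ≟ 1)) ([m+kn]%n≡m%n 0 s 2)

module TriangularTheta {c ℓ : Level} (R : CommutativeRing c ℓ) (N : ℕ) where
  open CommutativeRing R renaming (_+_ to _⊕_; _*_ to _⊛_; -_ to ⊖_)
  open RingSums R
  open PowerSeries R
  open Truncated R N
  open PodSeries R N
  open import Algebra.Properties.CommutativeSemiring.Exp commutativeSemiring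
  open import Algebra.Properties.CommutativeSemiring.Exp S.commutativeSemiring using () renaming (_^_ to _^ˢ_)
  open import Algebra.Properties.Ring ring using (-1*x≈-x)
  open import Algebra.Properties.Group +-group using (⁻¹-involutive)

  -- The choice x = -q turns 1 + q^(2s+1) into 1 - x^(2s+1) and leaves even powers alone, so the pod
  -- series at z = 1 is the reciprocal of Gauss's product in x.
  x : Series
  x = monomial 1 (⊖ 1#)

  x^-monomial : ∀ k → x ^ˢ k ≋ monomial k ((⊖ 1#) ^ k)
  x^-monomial zero    = S.refl
  x^-monomial (suc k) =
    S.trans (S.*-congˡ {x} (x^-monomial k)) (pointwise (monomial-*-monomial 1 k (⊖ 1#) ((⊖ 1#) ^ k)))

  -1^even : ∀ s → (⊖ 1#) ^ (s * 2) ≈ 1#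
  -1^even zero    = refl
  -1^even (suc s) = trans (-1*x≈-x _) (trans (-‿cong (-1*x≈-x _)) (trans (⁻¹-involutive _) (-1^even s)))

  -1^odd : ∀ s → (⊖ 1#) ^ (1 + s * 2) ≈ ⊖ 1#
  -1^odd s = trans (*-congˡ (-1^even s)) (*-identityʳ _)

  x^-vanish : ∀ k → N < k → x ^ˢ k ≋ 0ˢ
  x^-vanish k N<k = S.trans (x^-monomial k)
    (coefficientwise (λ n n≤N → monomial-> ((⊖ 1#) ^ k) (ℕ.≤-trans (s≤s n≤N) N<k)))

  x^-support : ∀ k f n → n ≤ N → (∀ m → k + m ≡ n → f m ≈ 0#) → ((x ^ˢ k) · f) n ≈ 0#
  x^-support k f n n≤N f≈0 =
    trans (at (S.*-congʳ {f} (x^-monomial k)) n n≤N)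
          (trans (monomial-· k ((⊖ 1#) ^ k) f n) (trans (*-congˡ shifted) (zeroʳ _)))
    where
    shifted : shift k f n ≈ 0#
    shifted with k ≤? n
    ... | yes k≤n = trans (shift-≤ f k≤n) (f≈0 (n ∸ k) (ℕ.m+[n∸m]≡n k≤n))
    ... | no  k≰n = shift-> f (ℕ.≰⇒> k≰n)

  -- The factor is 1 + q^j, and q^j cancels against x^j = -q^j; multiplicities from 2 on have weight
  -- 0.
  oddPart : ∀ s → partSeries 1# (1 + s * 2) S.+ x ^ˢ (1 + s * 2) ≋ 1ˢ
  oddPart s = begin
    partSeries 1# j S.+ x ^ˢ j
      ≈⟨ S.+-cong (S.+-cong (weight-monomial 0 (s≤s z≤n)) (S.+-cong (weight-monomial 1 (s≤s (s≤s z≤n))) rest))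
                  (S.trans (x^-monomial j) (pointwise (monomial-cong {j} ≡.refl (-1^odd s)))) ⟩
    1ˢ S.+ (monomial (1 * j) 1# S.+ 0ˢ) S.+ monomial j (⊖ 1#)
      ≈⟨ S.trans (S.+-assoc _ _ _) (S.+-congˡ (S.+-congʳ (S.+-identityʳ _))) ⟩
    1ˢ S.+ (monomial (1 * j) 1# S.+ monomial j (⊖ 1#))
      ≈⟨ S.+-congˡ (S.+-congʳ (pointwise (monomial-cong (ℕ.*-identityˡ j) refl))) ⟩
    1ˢ S.+ (monomial j 1# S.+ monomial j (⊖ 1#))
      ≈⟨ S.+-congˡ (pointwise (opposite j)) ⟩
    1ˢ S.+ 0ˢ
      ≈⟨ S.+-identityʳ 1ˢ ⟩
    1ˢ ∎
    where
    open import Relation.Binary.Reasoning.Setoid S.setoid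
    j = 1 + s * 2
    weight-small : ∀ k → k < 2 → weight j 1# k ≈ 1#
    weight-small zero          _ rewrite isOdd-odd s = refl
    weight-small (suc zero)    _ rewrite isOdd-odd s = *-identityʳ _
    weight-small (suc (suc _)) (s≤s (s≤s ()))
    weight-large : ∀ k → weight j 1# (2 + k) ≈ 0#
    weight-large k rewrite isOdd-odd s = refl
    weight-monomial : ∀ k → k < 2 → monomial (k * j) (weight j 1# k) ≋ monomial (k * j) 1#
    weight-monomial k k<2 = pointwise (monomial-cong {k * j} ≡.refl (weight-small k k<2))
    rest : SΣ.∑ N (λ k → monomial ((2 + k) * j) (weight j 1# (2 + k))) ≋ 0ˢ
    rest = SΣ.∑-0 N (λ k _ → pointwise (λ n →
      trans (monomial-cong {(2 + k) * j} ≡.refl (weight-large k) n) (monomial-0 ((2 + k) * j) n)))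
    opposite : ∀ k n → monomial k 1# n ⊕ monomial k (⊖ 1#) n ≈ 0#
    opposite zero    zero    = -‿inverseʳ 1#
    opposite zero    (suc n) = +-identityˡ 0#
    opposite (suc k) zero    = +-identityˡ 0#
    opposite (suc k) (suc n) = opposite k n

  -- Multiplication by x^j = q^j moves the geometric series up by one term. The term gained at the
  -- top has degree (N+2) j and vanishes modulo q^(N+1).
  evenPart : ∀ s → partSeries 1# (2 + s * 2) ≋ 1ˢ S.+ x ^ˢ (2 + s * 2) S.* partSeries 1# (2 + s * 2)
  evenPart s = begin
    partSeries 1# j
      ≈⟨ SΣ.∑-cong (2 + N) weight-monomial ⟩
    1ˢ S.+ SΣ.∑ (1 + N) (λ k → monomial (suc k * j) 1#)
      ≈⟨ S.+-congˡ (S.+-identityʳ _) ⟨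
    1ˢ S.+ (SΣ.∑ (1 + N) (λ k → monomial (suc k * j) 1#) S.+ 0ˢ)
      ≈⟨ S.+-congˡ (S.+-congˡ last-vanishes) ⟨
    1ˢ S.+ (SΣ.∑ (1 + N) (λ k → monomial (suc k * j) 1#) S.+ monomial ((2 + N) * j) 1#)
      ≈⟨ S.+-congˡ (SΣ.∑-last (1 + N) (λ k → monomial (suc k * j) 1#)) ⟨
    1ˢ S.+ SΣ.∑ (2 + N) (λ k → monomial (suc k * j) 1#)
      ≈⟨ S.+-congˡ (SΣ.∑-cong (2 + N) x^j·) ⟨
    1ˢ S.+ SΣ.∑ (2 + N) (λ k → x ^ˢ j S.* monomial (k * j) (weight j 1# k))
      ≈⟨ S.+-congˡ (SΣ.∑-distribˡ (x ^ˢ j) (2 + N) (λ k → monomial (k * j) (weight j 1# k))) ⟨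
    1ˢ S.+ x ^ˢ j S.* partSeries 1# j ∎
    where
    open import Relation.Binary.Reasoning.Setoid S.setoid
    j = 2 + s * 2
    1^ : ∀ k → 1# ^ k ≈ 1#
    1^ zero    = refl
    1^ (suc k) = trans (*-identityˡ _) (1^ k)
    weight-1 : ∀ k → weight j 1# k ≈ 1#
    weight-1 k rewrite isOdd-even (suc s) = 1^ k
    weight-monomial : ∀ k → monomial (k * j) (weight j 1# k) ≋ monomial (k * j) 1#
    weight-monomial k = pointwise (monomial-cong {k * j} ≡.refl (weight-1 k))
    last-vanishes : monomial ((2 + N) * j) 1# ≋ 0ˢ
    last-vanishes = coefficientwise λ n n≤N →
      monomial-> {(2 + N) * j} 1# (ℕ.≤-trans (s≤s (ℕ.m≤n⇒m≤1+n n≤N)) (ℕ.m≤m*n (2 + N) j))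
    x^j· : ∀ k → x ^ˢ j S.* monomial (k * j) (weight j 1# k) ≋ monomial (suc k * j) 1#
    x^j· k = S.trans (S.*-cong (x^-monomial j) (weight-monomial k)) (pointwise λ n →
      trans (monomial-*-monomial j (k * j) _ 1# n)
            (monomial-cong {suc k * j} ≡.refl (trans (*-identityʳ _) (-1^even (suc s))) n))

  -- One odd and one even part enter at a time, with factors 1 - x^(2s+1) and 1/(1 - x^(2s+2)). This
  -- is the recursion `b-step` for b_s = `podSeries 1# (s * 2)`.
  podSeries-step : ∀ s → podSeries 1# (suc s * 2) S.+ x ^ˢ (1 + s * 2) S.* podSeries 1# (s * 2) ≋
                         podSeries 1# (s * 2) S.+ x ^ˢ (2 + s * 2) S.* podSeries 1# (suc s * 2)
  podSeries-step s = begin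
    B′ S.+ xᵒ S.* B
      ≈⟨ S.+-congʳ B′≋ ⟩
    E S.* (O S.* B) S.+ xᵒ S.* B
      ≈⟨ S.+-congʳ (S.*-congʳ (evenPart s)) ⟩
    (1ˢ S.+ xᵉ S.* E) S.* (O S.* B) S.+ xᵒ S.* B
      ≈⟨ solve 6 (λ i xᵉ e o b xᵒ → (i :+ xᵉ :* e) :* (o :* b) :+ xᵒ :* b :=
                                    (i :* o :+ xᵒ) :* b :+ xᵉ :* (e :* (o :* b))) S.refl 1ˢ xᵉ E O B xᵒ ⟩
    (1ˢ S.* O S.+ xᵒ) S.* B S.+ xᵉ S.* (E S.* (O S.* B))
      ≈⟨ S.+-cong (S.*-congʳ (S.trans (S.+-congʳ (S.*-identityˡ O)) (oddPart s))) (S.*-congˡ {xᵉ} (S.sym B′≋)) ⟩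
    1ˢ S.* B S.+ xᵉ S.* B′
      ≈⟨ S.+-congʳ (S.*-identityˡ B) ⟩
    B S.+ xᵉ S.* B′ ∎
    where
    open import Relation.Binary.Reasoning.Setoid S.setoid
    open import Algebra.Solver.Ring.NaturalCoefficients.Default S.commutativeSemiring using (solve; _:+_; _:*_; _:=_)
    B = podSeries 1# (s * 2)
    B′ = podSeries 1# (suc s * 2)
    O = partSeries 1# (1 + s * 2)
    E = partSeries 1# (2 + s * 2)
    xᵒ = x ^ˢ (1 + s * 2)
    xᵉ = x ^ˢ (2 + s * 2)
    B′≋ : B′ ≋ E S.* (O S.* B)
    B′≋ = S.trans (podSeries-suc 1# (1 + s * 2)) (S.*-congˡ {E} (podSeries-suc 1# (s * 2)))

  θ : Series
  θ = SΣ.∑ (suc N) (λ s → x ^ˢ (s * (1 + s * 2)) S.+ x ^ˢ (suc s * (1 + s * 2)))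

  podSeries-θ : podSeries 1# (suc N * 2) S.* θ ≋ 1ˢ
  podSeries-θ = GaussIdentity.gauss seriesRing x N (x^-vanish (suc N) ℕ.≤-refl)
                  (λ s → podSeries 1# (s * 2)) (podSeries-0 1#) podSeries-step

  θ-support : ∀ f → (∀ s m → s * (1 + s * 2) + m ≡ N → f m ≈ 0#) →
              (∀ s m → suc s * (1 + s * 2) + m ≡ N → f m ≈ 0#) → (θ · f) N ≈ 0#
  θ-support f f≈0 f≈0′ = begin
    (θ · f) N
      ≈⟨ at (SΣ.∑-distribʳ f (suc N) (λ s → x ^ˢ (s * (1 + s * 2)) S.+ x ^ˢ (suc s * (1 + s * 2)))) N ℕ.≤-refl ⟩
    SΣ.∑ (suc N) (λ s → (x ^ˢ (s * (1 + s * 2)) S.+ x ^ˢ (suc s * (1 + s * 2))) S.* f) N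
      ≡⟨ SΣ-coefficient (suc N) (λ s → (x ^ˢ (s * (1 + s * 2)) S.+ x ^ˢ (suc s * (1 + s * 2))) S.* f) N ⟩
    ∑ (suc N) (λ s → ((x ^ˢ (s * (1 + s * 2)) S.+ x ^ˢ (suc s * (1 + s * 2))) · f) N)
      ≈⟨ ∑-0 (suc N) (λ s _ → summand s) ⟩
    0# ∎
    where
    open import Relation.Binary.Reasoning.Setoid setoid
    summand : ∀ s → ((x ^ˢ (s * (1 + s * 2)) S.+ x ^ˢ (suc s * (1 + s * 2))) · f) N ≈ 0#
    summand s = trans (·-distribʳ f (x ^ˢ (s * (1 + s * 2))) (x ^ˢ (suc s * (1 + s * 2))) N)
      (trans (+-cong (x^-support (s * (1 + s * 2)) f N ℕ.≤-refl (f≈0 s))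
                     (x^-support (suc s * (1 + s * 2)) f N ℕ.≤-refl (f≈0′ s)))
             (+-identityˡ 0#))

-- The rank series at a root of unity and its vanishing coefficients

-- Position p carries weight p, which agrees with the weight ±k of the multirank modulo t = s + 1.
linearRank : ∀ {s} → ℕ → Vec (List ℕ) s → ℕ
linearRank p []      = 0
linearRank p (π ∷ v) = p * length π + linearRank (suc p) v

module RootOfUnity {c ℓ : Level} (R : CommutativeRing c ℓ) (N t : ℕ) (t-prime : Prime t)
    (ζ : CommutativeRing.Carrier R) where
  open CommutativeRing R renaming (_+_ to _⊕_; _*_ to _⊛_; -_ to ⊖_)
  open RingSums R
  open ListSums R
  open PowerSeries R
  open Truncated R N
  open PodSeries R N
  open TriangularTheta R N
  open import Algebra.Properties.CommutativeSemiring.Exp commutativeSemiring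
  open RangeFold S.*-commutativeMonoid using ()
    renaming (fold to ∏; fold-cong to ∏-cong; fold-ε to ∏-1; fold-∙ to ∏-·; fold-rotate to ∏-rotate)
  module ≋-Reasoning where
    open import Relation.Binary.Reasoning.Setoid S.setoid public
  module ≈-Reasoning where
    open import Relation.Binary.Reasoning.Setoid setoid public

  coloredSeries : ℕ → ℕ → Series
  coloredSeries s p n = ∑ᴸ (λ v → ζ ^ linearRank p v) (coloredPods s n)

  -- Since ζ^(p ℓ) = (ζ^p)^ℓ, the colour at position p is counted by the pod series at z = ζ^p. The
  -- diagonal `podSeries (ζ ^ p) n n` appears because `pods n` bounds the parts by n itself.
  coloredSeries-suc : ∀ s p → coloredSeries (suc s) p ≋ (λ n → podSeries (ζ ^ p) n n) · coloredSeries s (suc p)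
  coloredSeries-suc s p = pointwise λ n → begin
    coloredSeries (suc s) p n
      ≈⟨ ∑ᴸ-concatMap _ (λ j → concatMap (λ π → map (π ∷_) (coloredPods s (n ∸ j))) (pods j)) (upTo (suc n)) ⟩
    ∑ᴸ (λ j → ∑ᴸ w (concatMap (λ π → map (π ∷_) (coloredPods s (n ∸ j))) (pods j))) (upTo (suc n))
      ≈⟨ ∑ᴸ-applyUpTo _ (λ j → j) (suc n) ⟩
    ∑ (suc n) (λ j → ∑ᴸ w (concatMap (λ π → map (π ∷_) (coloredPods s (n ∸ j))) (pods j)))
      ≈⟨ ∑-cong (suc n) (λ j → first j (n ∸ j)) ⟩
    ((λ n → podSeries (ζ ^ p) n n) · coloredSeries s (suc p)) n ∎
    where
    open ≈-Reasoning
    w : Vec (List ℕ) (suc s) → Carrier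
    w v = ζ ^ linearRank p v
    w-∷ : ∀ π v → w (π ∷ v) ≈ (ζ ^ p) ^ length π ⊛ ζ ^ linearRank (suc p) v
    w-∷ π v = trans (^-homo-* ζ (p * length π) (linearRank (suc p) v)) (*-congʳ (sym (^-assocʳ ζ p (length π))))
    first : ∀ j r → ∑ᴸ w (concatMap (λ π → map (π ∷_) (coloredPods s r)) (pods j)) ≈
                    podSeries (ζ ^ p) j j ⊛ coloredSeries s (suc p) r
    first j r = begin
      ∑ᴸ w (concatMap (λ π → map (π ∷_) (coloredPods s r)) (pods j))
        ≈⟨ ∑ᴸ-concatMap w (λ π → map (π ∷_) (coloredPods s r)) (pods j) ⟩
      ∑ᴸ (λ π → ∑ᴸ w (map (π ∷_) (coloredPods s r))) (pods j)
        ≈⟨ ∑ᴸ-cong (λ π → trans (∑ᴸ-map w (π ∷_) (coloredPods s r))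
             (trans (∑ᴸ-cong (w-∷ π) (coloredPods s r)) (∑ᴸ-distribˡ _ _ (coloredPods s r)))) (pods j) ⟩
      ∑ᴸ (λ π → (ζ ^ p) ^ length π ⊛ coloredSeries s (suc p) r) (pods j)
        ≈⟨ ∑ᴸ-distribʳ (coloredSeries s (suc p) r) _ (pods j) ⟩
      podSeries (ζ ^ p) j j ⊛ coloredSeries s (suc p) r ∎

  coloredSeries-∏ : ∀ {m} → N ≤ m → ∀ s p → coloredSeries s p ≋ ∏ s (λ k → podSeries (ζ ^ (k + p)) m)
  coloredSeries-∏ N≤m zero p = pointwise λ { zero → +-identityʳ _ ; (suc n) → refl }
  coloredSeries-∏ {m} N≤m (suc s) p = begin
    coloredSeries (suc s) p
      ≈⟨ coloredSeries-suc s p ⟩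
    (λ n → podSeries (ζ ^ p) n n) S.* coloredSeries s (suc p)
      ≈⟨ S.*-cong stable (coloredSeries-∏ N≤m s (suc p)) ⟩
    podSeries (ζ ^ p) m S.* ∏ s (λ k → podSeries (ζ ^ (k + suc p)) m)
      ≈⟨ S.*-congˡ {podSeries (ζ ^ p) m}
           (∏-cong s (λ k → S.reflexive (≡.cong (λ e → podSeries (ζ ^ e) m) (ℕ.+-suc k p)))) ⟩
    podSeries (ζ ^ p) m S.* ∏ s (λ k → podSeries (ζ ^ (suc k + p)) m) ∎
    where
    open ≋-Reasoning
    stable : (λ n → podSeries (ζ ^ p) n n) ≋ podSeries (ζ ^ p) m
    stable = coefficientwise λ n n≤N → sym (podSeries-stable (ζ ^ p) n≤N (ℕ.≤-trans n≤N N≤m))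

  -- The substitution of ζ q for q.
  σ : Series → Series
  σ f n = ζ ^ n ⊛ f n

  σ-cong : ∀ {f g} → f ≋ g → σ f ≋ σ g
  σ-cong f≋g = coefficientwise λ n n≤N → *-congˡ (at f≋g n n≤N)

  σ-1 : σ 1ˢ ≋ 1ˢ
  σ-1 = pointwise λ { zero → *-identityˡ _ ; (suc n) → zeroʳ _ }

  σ-· : ∀ f g → σ (f · g) ≋ σ f · σ g
  σ-· f g = pointwise λ n →
    trans (∑-distribˡ (ζ ^ n) (suc n) (λ i → f i ⊛ g (n ∸ i))) (∑-cong< (suc n) (λ { i (s≤s i≤n) → begin
      ζ ^ n ⊛ (f i ⊛ g (n ∸ i))
        ≡⟨ ≡.cong (λ e → ζ ^ e ⊛ (f i ⊛ g (n ∸ i))) (ℕ.m+[n∸m]≡n i≤n) ⟨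
      ζ ^ (i + (n ∸ i)) ⊛ (f i ⊛ g (n ∸ i))
        ≈⟨ *-congʳ (^-homo-* ζ i (n ∸ i)) ⟩
      ζ ^ i ⊛ ζ ^ (n ∸ i) ⊛ (f i ⊛ g (n ∸ i))
        ≈⟨ interchange _ _ _ _ ⟩
      ζ ^ i ⊛ f i ⊛ (ζ ^ (n ∸ i) ⊛ g (n ∸ i)) ∎ }))
    where
    open ≈-Reasoning
    open import Algebra.Properties.CommutativeSemigroup *-commutativeSemigroup using (interchange)

  σ-∏ : ∀ n f → σ (∏ n f) ≋ ∏ n (λ k → σ (f k))
  σ-∏ zero    f = σ-1
  σ-∏ (suc n) f = S.trans (σ-· (f 0) _) (S.*-congˡ {σ (f 0)} (σ-∏ n (λ k → f (suc k))))

  σ-monomial : ∀ k a → σ (monomial k a) ≋ monomial k (ζ ^ k ⊛ a)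
  σ-monomial k a = pointwise (coefficient k (λ n → ζ ^ n))
    where
    coefficient : ∀ k (u : Series) n → u n ⊛ monomial k a n ≈ monomial k (u k ⊛ a) n
    coefficient zero    u zero    = refl
    coefficient zero    u (suc n) = zeroʳ _
    coefficient (suc k) u zero    = zeroʳ _
    coefficient (suc k) u (suc n) = coefficient k (λ i → u (suc i)) n

  σ-SΣ : ∀ n f → σ (SΣ.∑ n f) ≋ SΣ.∑ n (λ k → σ (f k))
  σ-SΣ zero    f = pointwise λ _ → zeroʳ _
  σ-SΣ (suc n) f = S.trans (pointwise λ _ → distribˡ _ _ _) (S.+-congˡ {σ (f 0)} (σ-SΣ n (λ k → f (suc k))))

  weight-cong : ∀ j {z z′} k → z ^ k ≈ z′ ^ k → weight j z k ≈ weight j z′ k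
  weight-cong j k eq with admissible j k
  ... | true  = eq
  ... | false = refl

  partSeries-cong : ∀ j {z z′} → z ≈ z′ → partSeries z j ≋ partSeries z′ j
  partSeries-cong j z≈z′ = SΣ.∑-cong (2 + N) λ k →
    pointwise (monomial-cong {k * j} ≡.refl (weight-cong j k (^-congˡ k z≈z′)))

  -- A multiplicity i of the part j contributes (z q^j)^i, so the substitution replaces z by z ζ^j.
  -- The parity restriction depends on j and i alone and is preserved.
  σ-partSeries : ∀ k j → σ (partSeries (ζ ^ k) j) ≋ partSeries (ζ ^ (k + j)) j
  σ-partSeries k j = S.trans (σ-SΣ (2 + N) (λ i → monomial (i * j) (weight j (ζ ^ k) i)))
    (SΣ.∑-cong (2 + N) (λ i → S.trans (σ-monomial (i * j) _) (pointwise (monomial-cong {i * j} ≡.refl (weights i)))))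
    where
    open ≈-Reasoning
    exponent : ∀ i j k → i * j + k * i ≡ (k + j) * i
    exponent = solve-∀
    weights : ∀ i → ζ ^ (i * j) ⊛ weight j (ζ ^ k) i ≈ weight j (ζ ^ (k + j)) i
    weights i with admissible j i
    ... | false = zeroʳ _
    ... | true  = begin
      ζ ^ (i * j) ⊛ (ζ ^ k) ^ i   ≈⟨ *-congˡ (^-assocʳ ζ k i) ⟩
      ζ ^ (i * j) ⊛ ζ ^ (k * i)   ≈⟨ ^-homo-* ζ (i * j) (k * i) ⟨
      ζ ^ (i * j + k * i)         ≡⟨ ≡.cong (ζ ^_) (exponent i j k) ⟩
      ζ ^ ((k + j) * i)           ≈⟨ ^-assocʳ ζ (k + j) i ⟨
      (ζ ^ (k + j)) ^ i           ∎

  module _ (ζ^t≈1 : ζ ^ t ≈ 1#) where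

    ζ-periodic : ∀ i → ζ ^ (t + i) ≈ ζ ^ i
    ζ-periodic i = trans (^-homo-* ζ t i) (trans (*-congʳ ζ^t≈1) (*-identityˡ _))

    -- σ sends the factor of the part j at ζ^k to the one at ζ^(k+j), so it permutes each of these products.
    σ-invariant : ∀ m → σ (∏ t (λ k → podSeries (ζ ^ k) m)) ≋ ∏ t (λ k → podSeries (ζ ^ k) m)
    σ-invariant zero    = S.trans (σ-cong trivial) (S.trans σ-1 (S.sym trivial))
      where
      trivial : ∏ t (λ k → podSeries (ζ ^ k) 0) ≋ 1ˢ
      trivial = ∏-1 t (λ k _ → podSeries-0 (ζ ^ k))
    σ-invariant (suc m) = begin
      σ (∏ t (λ k → podSeries (ζ ^ k) (suc m)))
        ≈⟨ σ-cong factor ⟩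
      σ (E S.* B)
        ≈⟨ σ-· E B ⟩
      σ E S.* σ B
        ≈⟨ S.*-cong E-invariant (σ-invariant m) ⟩
      E S.* B
        ≈⟨ factor ⟨
      ∏ t (λ k → podSeries (ζ ^ k) (suc m)) ∎
      where
      open ≋-Reasoning
      E = ∏ t (λ k → partSeries (ζ ^ k) (suc m))
      B = ∏ t (λ k → podSeries (ζ ^ k) m)
      factor : ∏ t (λ k → podSeries (ζ ^ k) (suc m)) ≋ E S.* B
      factor = S.trans (∏-cong t (λ k → podSeries-suc (ζ ^ k) m)) (∏-· t _ _)
      E-invariant : σ E ≋ E
      E-invariant = begin
        σ E
          ≈⟨ σ-∏ t (λ k → partSeries (ζ ^ k) (suc m)) ⟩
        ∏ t (λ k → σ (partSeries (ζ ^ k) (suc m)))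
          ≈⟨ ∏-cong t (λ k → σ-partSeries k (suc m)) ⟩
        ∏ t (λ k → partSeries (ζ ^ (k + suc m)) (suc m))
          ≈⟨ ∏-rotate t (λ k → partSeries (ζ ^ k) (suc m)) (λ k → partSeries-cong (suc m) (ζ-periodic k)) (suc m) ⟩
        E ∎

    module _ (∑ζ≈0 : ∑ t (λ k → ζ ^ k) ≈ 0#)
             (torsion-free : ∀ a → ∑ t (λ _ → a) ≈ 0# → a ≈ 0#) where

      -- The exponents e with ζ^e a = a include the multiples of n and of t, which are coprime, so ζ
      -- a = a. Summing ζ^k a = a over a period gives t a = (∑ ζ^k) a = 0.
      ζ^n-fixed⇒0 : ∀ n a → ¬ (t ∣ n) → ζ ^ n ⊛ a ≈ a → a ≈ 0#
      ζ^n-fixed⇒0 n a t∤n fixed = torsion-free a (begin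
        ∑ t (λ _ → a)          ≈⟨ ∑-cong t (λ k → power ζ ζ-fixed k) ⟨
        ∑ t (λ k → ζ ^ k ⊛ a)  ≈⟨ ∑-distribʳ a t (λ k → ζ ^ k) ⟨
        ∑ t (λ k → ζ ^ k) ⊛ a  ≈⟨ *-congʳ ∑ζ≈0 ⟩
        0# ⊛ a                 ≈⟨ zeroˡ a ⟩
        0#                     ∎)
        where
        open ≈-Reasoning
        power : ∀ u → u ⊛ a ≈ a → ∀ k → u ^ k ⊛ a ≈ a
        power u ua≈a zero    = *-identityˡ a
        power u ua≈a (suc k) = trans (*-assoc _ _ _) (trans (*-congˡ (power u ua≈a k)) ua≈a)
        multiples-of-n : ∀ y → ζ ^ (y * n) ⊛ a ≈ a
        multiples-of-n y = trans (*-congʳ (trans (^-congʳ ζ (ℕ.*-comm y n)) (sym (^-assocʳ ζ n y)))) (power (ζ ^ n) fixed y)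
        multiples-of-t : ∀ y → ζ ^ (y * t) ⊛ a ≈ a
        multiples-of-t y = trans (*-congʳ (trans (^-congʳ ζ (ℕ.*-comm y t)) (sym (^-assocʳ ζ t y))))
          (power (ζ ^ t) (trans (*-congʳ ζ^t≈1) (*-identityˡ a)) y)
        coprime : Coprime t n
        coprime (d∣t , d∣n) with prime⇒irreducible t-prime d∣t
        ... | inj₁ d≡1    = d≡1
        ... | inj₂ ≡.refl = contradiction d∣n t∤n
        -- In either sign case Bézout's identity provides two consecutive exponents, one a multiple
        -- of n and the other of t; their quotient is ζ, with no inverse taken.
        bézout : ∀ e e′ → 1 + e ≡ e′ → ζ ^ e ⊛ a ≈ a → ζ ^ e′ ⊛ a ≈ a → ζ ⊛ a ≈ a
        bézout e e′ eq fix fix′ = begin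
          ζ ⊛ a             ≈⟨ *-congˡ fix ⟨
          ζ ⊛ (ζ ^ e ⊛ a)   ≈⟨ *-assoc _ _ _ ⟨
          ζ ^ (1 + e) ⊛ a   ≡⟨ ≡.cong (λ e → ζ ^ e ⊛ a) eq ⟩
          ζ ^ e′ ⊛ a        ≈⟨ fix′ ⟩
          a                 ∎
        ζ-fixed : ζ ⊛ a ≈ a
        ζ-fixed with coprime-Bézout coprime
        ... | Bézout.+- x y eq = bézout (y * n) (x * t) eq (multiples-of-n y) (multiples-of-t x)
        ... | Bézout.-+ x y eq = bézout (x * t) (y * n) eq (multiples-of-t x) (multiples-of-n y)

      coloredSeries-vanishes : ∀ s → t ≡ suc s → .{{_ : NonZero t}} → QuadNonResidue (8 * N + 1) t →
                               coloredSeries s 1 N ≈ 0#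
      coloredSeries-vanishes s ≡.refl nonresidue = begin
        coloredSeries s 1 N
          ≈⟨ at (coloredSeries-∏ (ℕ.≤-trans (ℕ.n≤1+n N) (ℕ.m≤m*n (suc N) 2)) s 1) N ℕ.≤-refl ⟩
        A N
          ≈⟨ at A≋θ·F N ℕ.≤-refl ⟩
        (θ · F) N
          -- For T = r(2r+1) or (r+1)(2r+1), the number 8T + 1 is the square of 4r + 1 or 4r + 3. If
          -- N = T + m with t dividing m, that square would be congruent to 8N + 1; so t does not
          -- divide m and `F m` vanishes.
          ≈⟨ θ-support F (λ r m eq → vanish m (1 + 4 * r) (m≤ (r * (1 + r * 2)) eq) (square-even r m eq))
                         (λ r m eq → vanish m (3 + 4 * r) (m≤ (suc r * (1 + r * 2)) eq) (square-odd r m eq)) ⟩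
        0# ∎
        where
        open ≈-Reasoning
        -- A bound on the parts that is at least N, hence harmless for the coefficients compared,
        -- and equal to the one at which `podSeries-θ` holds.
        M = suc N * 2
        A = ∏ s (λ k → podSeries (ζ ^ (k + 1)) M)
        F = ∏ t (λ k → podSeries (ζ ^ k) M)
        F≋ : F ≋ podSeries 1# M S.* A
        F≋ = S.*-congˡ {podSeries 1# M}
          (∏-cong s (λ k → S.reflexive (≡.cong (λ e → podSeries (ζ ^ e) M) (ℕ.+-comm 1 k))))
        A≋θ·F : A ≋ θ S.* F
        A≋θ·F = S.sym (S.trans (S.*-congˡ {θ} F≋) (S.trans (S.sym (S.*-assoc θ (podSeries 1# M) A))
          (S.trans (S.*-congʳ {A} (S.trans (S.*-comm θ (podSeries 1# M)) podSeries-θ)) (S.*-identityˡ A))))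
        m≤ : ∀ {m} k → k + m ≡ N → m ≤ N
        m≤ k ≡.refl = ℕ.m≤n+m _ k
        square-even : ∀ r m → r * (1 + r * 2) + m ≡ N → (1 + 4 * r) * (1 + 4 * r) + 8 * m ≡ 8 * N + 1
        square-even r m ≡.refl = identity r m
          where
          identity : ∀ r m → (1 + 4 * r) * (1 + 4 * r) + 8 * m ≡ 8 * (r * (1 + r * 2) + m) + 1
          identity = solve-∀
        square-odd : ∀ r m → suc r * (1 + r * 2) + m ≡ N → (3 + 4 * r) * (3 + 4 * r) + 8 * m ≡ 8 * N + 1
        square-odd r m ≡.refl = identity r m
          where
          identity : ∀ r m → (3 + 4 * r) * (3 + 4 * r) + 8 * m ≡ 8 * (suc r * (1 + r * 2) + m) + 1
          identity = solve-∀
        F-support : ∀ m → m ≤ N → ¬ (t ∣ m) → F m ≈ 0#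
        F-support m m≤N t∤m = ζ^n-fixed⇒0 m (F m) t∤m (at (σ-invariant M) m m≤N)
        vanish : ∀ m r → m ≤ N → r * r + 8 * m ≡ 8 * N + 1 → F m ≈ 0#
        vanish m r m≤N eq = F-support m m≤N λ { (divides d ≡.refl) → nonresidue (r , ≡.sym (≡.trans
          (≡.cong (_% t) (≡.trans (≡.sym eq) (≡.cong (λ e → r * r + e) (≡.sym (ℕ.*-assoc 8 d t)))))
          ([m+kn]%n≡m%n (r * r) (8 * d) t))) }

-- A ring containing a t-th root of unity: operators on periodic sequences

module Z∑ = RingSums ℤ.+-*-commutativeRing

-- ℤ[ζ] is realised as the integer polynomials in the shift 𝕫, identified when they act alike on the
-- t-periodic sequences of mean zero; irreducibility of the cyclotomic polynomial is never needed.
data Op : Set where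
  𝟘 𝟙 𝕫 : Op
  _⊞_ _⊠_ : Op → Op → Op
  ⊟_ : Op → Op

⟦_⟧ : Op → (ℕ → ℤ) → ℕ → ℤ
⟦ 𝟘 ⟧     φ x = + 0
⟦ 𝟙 ⟧     φ x = φ x
⟦ 𝕫 ⟧     φ x = φ (suc x)
⟦ a ⊞ b ⟧ φ x = ⟦ a ⟧ φ x ℤ.+ ⟦ b ⟧ φ x
⟦ a ⊠ b ⟧ φ x = ⟦ a ⟧ (⟦ b ⟧ φ) x
⟦ ⊟ a ⟧   φ x = ℤ.- ⟦ a ⟧ φ x

⟦⟧-cong : ∀ a {φ ψ} → (∀ x → φ x ≡ ψ x) → ∀ x → ⟦ a ⟧ φ x ≡ ⟦ a ⟧ ψ x
⟦⟧-cong 𝟘       eq x = ≡.refl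
⟦⟧-cong 𝟙       eq x = eq x
⟦⟧-cong 𝕫       eq x = eq (suc x)
⟦⟧-cong (a ⊞ b) eq x = ≡.cong₂ ℤ._+_ (⟦⟧-cong a eq x) (⟦⟧-cong b eq x)
⟦⟧-cong (a ⊠ b) eq x = ⟦⟧-cong a (⟦⟧-cong b eq) x
⟦⟧-cong (⊟ a)   eq x = ≡.cong ℤ.-_ (⟦⟧-cong a eq x)

⟦⟧-0 : ∀ a x → ⟦ a ⟧ (λ _ → + 0) x ≡ + 0
⟦⟧-0 𝟘       x = ≡.refl
⟦⟧-0 𝟙       x = ≡.refl
⟦⟧-0 𝕫       x = ≡.refl
⟦⟧-0 (a ⊞ b) x = ≡.cong₂ ℤ._+_ (⟦⟧-0 a x) (⟦⟧-0 b x)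
⟦⟧-0 (a ⊠ b) x = ≡.trans (⟦⟧-cong a (⟦⟧-0 b) x) (⟦⟧-0 a x)
⟦⟧-0 (⊟ a)   x = ≡.cong ℤ.-_ (⟦⟧-0 a x)

⟦⟧-+ : ∀ a φ ψ x → ⟦ a ⟧ (λ y → φ y ℤ.+ ψ y) x ≡ ⟦ a ⟧ φ x ℤ.+ ⟦ a ⟧ ψ x
⟦⟧-+ 𝟘       φ ψ x = ≡.refl
⟦⟧-+ 𝟙       φ ψ x = ≡.refl
⟦⟧-+ 𝕫       φ ψ x = ≡.refl
⟦⟧-+ (a ⊞ b) φ ψ x = ≡.trans (≡.cong₂ ℤ._+_ (⟦⟧-+ a φ ψ x) (⟦⟧-+ b φ ψ x))
  (interchange (⟦ a ⟧ φ x) (⟦ a ⟧ ψ x) (⟦ b ⟧ φ x) (⟦ b ⟧ ψ x))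
  where open import Algebra.Properties.CommutativeSemigroup ℤ.+-commutativeSemigroup using (interchange)
⟦⟧-+ (a ⊠ b) φ ψ x = ≡.trans (⟦⟧-cong a (⟦⟧-+ b φ ψ) x) (⟦⟧-+ a (⟦ b ⟧ φ) (⟦ b ⟧ ψ) x)
⟦⟧-+ (⊟ a)   φ ψ x = ≡.trans (≡.cong ℤ.-_ (⟦⟧-+ a φ ψ x)) (ℤ.neg-distrib-+ (⟦ a ⟧ φ x) (⟦ a ⟧ ψ x))

⟦⟧-neg : ∀ a φ x → ⟦ a ⟧ (λ y → ℤ.- φ y) x ≡ ℤ.- ⟦ a ⟧ φ x
⟦⟧-neg 𝟘       φ x = ≡.refl
⟦⟧-neg 𝟙       φ x = ≡.refl
⟦⟧-neg 𝕫       φ x = ≡.refl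
⟦⟧-neg (a ⊞ b) φ x = ≡.trans (≡.cong₂ ℤ._+_ (⟦⟧-neg a φ x) (⟦⟧-neg b φ x))
                             (≡.sym (ℤ.neg-distrib-+ (⟦ a ⟧ φ x) (⟦ b ⟧ φ x)))
⟦⟧-neg (a ⊠ b) φ x = ≡.trans (⟦⟧-cong a (⟦⟧-neg b φ) x) (⟦⟧-neg a (⟦ b ⟧ φ) x)
⟦⟧-neg (⊟ a)   φ x = ≡.cong ℤ.-_ (⟦⟧-neg a φ x)

⟦⟧-suc : ∀ a φ x → ⟦ a ⟧ (λ y → φ (suc y)) x ≡ ⟦ a ⟧ φ (suc x)
⟦⟧-suc 𝟘       φ x = ≡.refl
⟦⟧-suc 𝟙       φ x = ≡.refl
⟦⟧-suc 𝕫       φ x = ≡.refl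
⟦⟧-suc (a ⊞ b) φ x = ≡.cong₂ ℤ._+_ (⟦⟧-suc a φ x) (⟦⟧-suc b φ x)
⟦⟧-suc (a ⊠ b) φ x = ≡.trans (⟦⟧-cong a (⟦⟧-suc b φ) x) (⟦⟧-suc a (⟦ b ⟧ φ) x)
⟦⟧-suc (⊟ a)   φ x = ≡.cong ℤ.-_ (⟦⟧-suc a φ x)

-- All operators are additive and generated by the shift, which commutes with each of them by
-- `⟦⟧-suc`; hence composition is commutative.
⟦⟧-comm : ∀ a b φ x → ⟦ a ⟧ (⟦ b ⟧ φ) x ≡ ⟦ b ⟧ (⟦ a ⟧ φ) x
⟦⟧-comm 𝟘        b φ x = ≡.sym (⟦⟧-0 b x)
⟦⟧-comm 𝟙        b φ x = ≡.refl
⟦⟧-comm 𝕫        b φ x = ≡.sym (⟦⟧-suc b φ x)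
⟦⟧-comm (a ⊞ a′) b φ x = ≡.trans (≡.cong₂ ℤ._+_ (⟦⟧-comm a b φ x) (⟦⟧-comm a′ b φ x))
                                 (≡.sym (⟦⟧-+ b (⟦ a ⟧ φ) (⟦ a′ ⟧ φ) x))
⟦⟧-comm (a ⊠ a′) b φ x = ≡.trans (⟦⟧-cong a (⟦⟧-comm a′ b φ) x) (⟦⟧-comm a b (⟦ a′ ⟧ φ) x)
⟦⟧-comm (⊟ a)    b φ x = ≡.trans (≡.cong ℤ.-_ (⟦⟧-comm a b φ x)) (≡.sym (⟦⟧-neg b (⟦ a ⟧ φ) x))

∑-const : ∀ n u → Z∑.∑ n (λ _ → u) ≡ + n ℤ.* u
∑-const zero    u = ≡.sym (ℤ.*-zeroˡ u)
∑-const (suc n) u = ≡.trans (≡.cong (ℤ._+_ u) (∑-const n u)) (≡.sym (ℤ.suc-* (+ n) u))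

module Cyclotomic (t : ℕ) where

  -- The two conditions are dual to the relations imposed on ζ: periodicity makes `𝕫 ^ t` act as the
  -- identity, and vanishing sums over windows of length t make ∑ `𝕫 ^ k` act as zero.
  record MeanZero (φ : ℕ → ℤ) : Set where
    field
      periodic : ∀ x → φ (t + x) ≡ φ x
      mean     : ∀ x → Z∑.∑ t (λ k → φ (k + x)) ≡ + 0

  open MeanZero public

  ⟦⟧-∑ : ∀ a n (φ : ℕ → ℕ → ℤ) x → ⟦ a ⟧ (λ y → Z∑.∑ n (λ k → φ k y)) x ≡ Z∑.∑ n (λ k → ⟦ a ⟧ (φ k) x)
  ⟦⟧-∑ a zero    φ x = ⟦⟧-0 a x
  ⟦⟧-∑ a (suc n) φ x = ≡.trans (⟦⟧-+ a (φ 0) _ x) (≡.cong (ℤ._+_ (⟦ a ⟧ (φ 0) x)) (⟦⟧-∑ a n (λ k → φ (suc k)) x))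

  ⟦⟧-translate : ∀ a φ k x → ⟦ a ⟧ φ (k + x) ≡ ⟦ a ⟧ (λ y → φ (k + y)) x
  ⟦⟧-translate a φ zero    x = ≡.refl
  ⟦⟧-translate a φ (suc k) x = ≡.trans (≡.sym (⟦⟧-suc a φ (k + x))) (⟦⟧-translate a (λ y → φ (suc y)) k x)

  -- Stability of these sequences under the operators makes `_≈_` compatible with composition: the
  -- left operator is compared on the image of the right one.
  ⟦⟧-meanZero : ∀ a {φ} → MeanZero φ → MeanZero (⟦ a ⟧ φ)
  ⟦⟧-meanZero a {φ} φ₀ = record
    { periodic = λ x → ≡.trans (⟦⟧-translate a φ t x) (⟦⟧-cong a (periodic φ₀) x)
    ; mean     = λ x → ≡.trans (Z∑.∑-cong t (λ k → ⟦⟧-translate a φ k x))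
                   (≡.trans (≡.sym (⟦⟧-∑ a t (λ k y → φ (k + y)) x))
                     (≡.trans (⟦⟧-cong a (mean φ₀) x) (⟦⟧-0 a x)))
    }

  infix 4 _≈_

  record _≈_ (a b : Op) : Set where
    constructor sameAction
    field
      action : ∀ {φ} → MeanZero φ → ∀ x → ⟦ a ⟧ φ x ≡ ⟦ b ⟧ φ x

  open _≈_ public

  ring : CommutativeRing _ _
  ring = record
    { Carrier = Op
    ; _≈_ = _≈_
    ; _+_ = _⊞_
    ; _*_ = _⊠_
    ; -_  = ⊟_
    ; 0#  = 𝟘
    ; 1#  = 𝟙
    ; isCommutativeRing = record
      { isRing = record
        { +-isAbelianGroup = record
          { isGroup = record
            { isMonoid = record
              { isSemigroup = record
                { isMagma = record
                  { isEquivalence = record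
                    { refl  = sameAction λ _ _ → ≡.refl
                    ; sym   = λ p → sameAction λ φ₀ x → ≡.sym (action p φ₀ x)
                    ; trans = λ p q → sameAction λ φ₀ x → ≡.trans (action p φ₀ x) (action q φ₀ x)
                    }
                  ; ∙-cong = λ p q → sameAction λ φ₀ x → ≡.cong₂ ℤ._+_ (action p φ₀ x) (action q φ₀ x)
                  }
                ; assoc = λ a b c → sameAction λ {φ} _ x → ℤ.+-assoc (⟦ a ⟧ φ x) (⟦ b ⟧ φ x) (⟦ c ⟧ φ x)
                }
              ; identity = (λ a → sameAction λ _ _ → ℤ.+-identityˡ _) , (λ a → sameAction λ _ _ → ℤ.+-identityʳ _)
              }
            ; inverse = (λ a → sameAction λ {φ} _ x → ℤ.+-inverseˡ (⟦ a ⟧ φ x))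
                      , (λ a → sameAction λ {φ} _ x → ℤ.+-inverseʳ (⟦ a ⟧ φ x))
            ; ⁻¹-cong = λ p → sameAction λ φ₀ x → ≡.cong ℤ.-_ (action p φ₀ x)
            }
          ; comm = λ a b → sameAction λ {φ} _ x → ℤ.+-comm (⟦ a ⟧ φ x) (⟦ b ⟧ φ x)
          }
        ; *-cong = λ {a} {a′} {b} {b′} p q → sameAction λ φ₀ x →
            ≡.trans (action p (⟦⟧-meanZero b φ₀) x) (⟦⟧-cong a′ (action q φ₀) x)
        ; *-assoc = λ a b c → sameAction λ _ _ → ≡.refl
        ; *-identity = (λ a → sameAction λ _ _ → ≡.refl) , (λ a → sameAction λ _ _ → ≡.refl)
        ; distrib = (λ a b c → sameAction λ {φ} _ x → ⟦⟧-+ a (⟦ b ⟧ φ) (⟦ c ⟧ φ) x)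
                  , (λ a b c → sameAction λ _ _ → ≡.refl)
        }
      ; *-comm = λ a b → sameAction λ {φ} _ x → ⟦⟧-comm a b φ x
      }
    }

  open RingSums ring using (∑)
  open import Algebra.Properties.CommutativeSemiring.Exp (CommutativeRing.commutativeSemiring ring) using (_^_)

  ⟦𝕫^⟧ : ∀ k φ x → ⟦ 𝕫 ^ k ⟧ φ x ≡ φ (k + x)
  ⟦𝕫^⟧ zero    φ x = ≡.refl
  ⟦𝕫^⟧ (suc k) φ x = ≡.trans (⟦𝕫^⟧ k φ (suc x)) (≡.cong φ (ℕ.+-suc k x))

  ⟦∑⟧ : ∀ n f φ x → ⟦ ∑ n f ⟧ φ x ≡ Z∑.∑ n (λ k → ⟦ f k ⟧ φ x)
  ⟦∑⟧ zero    f φ x = ≡.refl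
  ⟦∑⟧ (suc n) f φ x = ≡.cong (ℤ._+_ (⟦ f 0 ⟧ φ x)) (⟦∑⟧ n (λ k → f (suc k)) φ x)

  𝕫^t≈1 : 𝕫 ^ t ≈ 𝟙
  𝕫^t≈1 = sameAction λ {φ} φ₀ x → ≡.trans (⟦𝕫^⟧ t φ x) (periodic φ₀ x)

  ∑𝕫≈0 : ∑ t (λ k → 𝕫 ^ k) ≈ 𝟘
  ∑𝕫≈0 = sameAction λ {φ} φ₀ x →
    ≡.trans (⟦∑⟧ t (λ k → 𝕫 ^ k) φ x) (≡.trans (Z∑.∑-cong t (λ k → ⟦𝕫^⟧ k φ x)) (mean φ₀ x))

  torsion-free : .{{_ : NonZero t}} → ∀ a → ∑ t (λ _ → a) ≈ 𝟘 → a ≈ 𝟘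
  torsion-free a ta≈0 = sameAction λ {φ} φ₀ x → cancel (⟦ a ⟧ φ x)
      (≡.trans (≡.sym (∑-const t (⟦ a ⟧ φ x)))
               (≡.trans (≡.sym (⟦∑⟧ t (λ _ → a) φ x)) (action ta≈0 φ₀ x)))
    where
    cancel : ∀ u → + t ℤ.* u ≡ + 0 → u ≡ + 0
    cancel u eq with ℤ.i*j≡0⇒i≡0∨j≡0 (+ t) eq
    ... | inj₁ t≡0 = contradiction (ℤ.+-injective t≡0) (≢-nonZero⁻¹ t)
    ... | inj₂ u≡0 = u≡0

-- From a vanishing sum of powers to equal residue classes

∑-δ : ∀ {n i} → i < n → Z∑.∑ n (λ k → if does (k ≟ i) then + 1 else + 0) ≡ + 1
∑-δ {suc n} {zero}  _         = ≡.cong (ℤ._+_ (+ 1)) (Z∑.∑-0 n (λ _ _ → ≡.refl))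
∑-δ {suc n} {suc i} (s≤s i<n) = ≡.trans (ℤ.+-identityˡ _) (∑-δ i<n)

module Equidistribution (t : ℕ) .{{_ : NonZero t}} where
  open Cyclotomic t
  open ListSums ring using (∑ᴸ)
  open import Algebra.Properties.CommutativeSemiring.Exp (CommutativeRing.commutativeSemiring ring) using (_^_)

  indicator : ℕ → ℕ → ℤ
  indicator i x = if does (x % t ≟ i) then + 1 else + 0

  -- The indicator of a residue class has mean 1/t over a period. Scaling by t and subtracting 1
  -- yields an integral sequence of mean zero, on which the operators may be tested.
  residueTest : ℕ → ℕ → ℤ
  residueTest i x = + t ℤ.* indicator i x ℤ.+ ℤ.- + 1

  indicator-periodic : ∀ i x → indicator i (t + x) ≡ indicator i x
  indicator-periodic i x = ≡.cong (λ r → if does (r ≟ i) then + 1 else + 0)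
    (≡.trans (≡.cong (_% t) (ℕ.+-comm t x)) ([m+n]%n≡m%n x t))

  residueTest-meanZero : ∀ {i} → i < t → MeanZero (residueTest i)
  residueTest-meanZero {i} i<t = record
    { periodic = λ x → ≡.cong (λ u → + t ℤ.* u ℤ.+ ℤ.- + 1) (indicator-periodic i x)
    ; mean     = λ x → begin
        Z∑.∑ t (λ k → residueTest i (k + x))
          ≡⟨ Z∑.∑-+ t (λ k → + t ℤ.* indicator i (k + x)) (λ _ → ℤ.- + 1) ⟩
        Z∑.∑ t (λ k → + t ℤ.* indicator i (k + x)) ℤ.+ Z∑.∑ t (λ _ → ℤ.- + 1)
          ≡⟨ ≡.cong₂ ℤ._+_ (≡.sym (Z∑.∑-distribˡ (+ t) t (λ k → indicator i (k + x)))) (∑-const t (ℤ.- + 1)) ⟩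
        + t ℤ.* Z∑.∑ t (λ k → indicator i (k + x)) ℤ.+ + t ℤ.* (ℤ.- + 1)
          ≡⟨ ≡.cong (λ u → + t ℤ.* u ℤ.+ + t ℤ.* (ℤ.- + 1)) (period x) ⟩
        + t ℤ.* + 1 ℤ.+ + t ℤ.* (ℤ.- + 1)
          ≡⟨ ℤ.*-distribˡ-+ (+ t) (+ 1) (ℤ.- + 1) ⟨
        + t ℤ.* + 0
          ≡⟨ ℤ.*-zeroʳ (+ t) ⟩
        + 0 ∎
    }
    where
    open ≡.≡-Reasoning
    period : ∀ x → Z∑.∑ t (λ k → indicator i (k + x)) ≡ + 1
    period x = ≡.trans (Z∑.∑-rotate t (indicator i) (indicator-periodic i) x)
      (≡.trans (Z∑.∑-cong< t (λ k k<t → ≡.cong (λ r → if does (r ≟ i) then + 1 else + 0) (m<n⇒m%n≡m k<t))) (∑-δ i<t))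

  module _ {A : Set} (e : A → ℕ) (p : A → Bool) (i : ℕ) (p≡ : ∀ v → p v ≡ does (e v % t ≟ i)) where

    -- At 0 the operator `𝕫 ^ e` reads off the entry e, so each `v` contributes t - 1 or -1
    -- according to its class. Adding the length restores the ones subtracted, leaving t for each
    -- hit.
    residueTest-∑ᴸ : ∀ xs → ⟦ ∑ᴸ (λ v → 𝕫 ^ e v) xs ⟧ (residueTest i) 0 ℤ.+ + length xs ≡
                            + (t * length (filterᵇ p xs))
    residueTest-∑ᴸ []       = ≡.cong +_ (≡.sym (ℕ.*-zeroʳ t))
    residueTest-∑ᴸ (v ∷ xs) = ≡.trans (≡.cong₂ (λ u w → u ℤ.+ rest ℤ.+ w) head (ℤ.pos-+ 1 (length xs))) step
      where
      rest = ⟦ ∑ᴸ (λ v → 𝕫 ^ e v) xs ⟧ (residueTest i) 0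
      head : ⟦ 𝕫 ^ e v ⟧ (residueTest i) 0 ≡ + t ℤ.* (if p v then + 1 else + 0) ℤ.+ ℤ.- + 1
      head = ≡.trans (⟦𝕫^⟧ (e v) (residueTest i) 0)
        (≡.trans (≡.cong (residueTest i) (ℕ.+-identityʳ (e v)))
                 (≡.cong (λ b → + t ℤ.* (if b then + 1 else + 0) ℤ.+ ℤ.- + 1) (≡.sym (p≡ v))))
      regroup : ∀ t r l → t ℤ.* + 1 ℤ.+ ℤ.- + 1 ℤ.+ r ℤ.+ (+ 1 ℤ.+ l) ≡ t ℤ.+ (r ℤ.+ l)
      regroup = solve-ℤ
      regroup₀ : ∀ t r l → t ℤ.* + 0 ℤ.+ ℤ.- + 1 ℤ.+ r ℤ.+ (+ 1 ℤ.+ l) ≡ r ℤ.+ l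
      regroup₀ = solve-ℤ
      step : + t ℤ.* (if p v then + 1 else + 0) ℤ.+ ℤ.- + 1 ℤ.+ rest ℤ.+ (+ 1 ℤ.+ + length xs) ≡
             + (t * length (filterᵇ p (v ∷ xs)))
      step with p v
      ... | true  = ≡.trans (regroup (+ t) rest (+ length xs)) (≡.trans (≡.cong (ℤ._+_ (+ t)) (residueTest-∑ᴸ xs))
                      (≡.cong +_ (≡.sym (ℕ.*-suc t (length (filterᵇ p xs))))))
      ... | false = ≡.trans (regroup₀ (+ t) rest (+ length xs)) (residueTest-∑ᴸ xs)

    equidistributed : i < t → ∀ xs → ∑ᴸ (λ v → 𝕫 ^ e v) xs ≈ 𝟘 → t * length (filterᵇ p xs) ≡ length xs
    equidistributed i<t xs ∑≈0 = ℤ.+-injective (≡.trans (≡.sym (residueTest-∑ᴸ xs))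
      (≡.trans (≡.cong (ℤ._+ + length xs) (action ∑≈0 (residueTest-meanZero i<t) 0)) (ℤ.+-identityˡ _)))

-- The multirank modulo t as a linear rank

%ℕ-unique : ∀ t .{{_ : NonZero t}} m w c → + w ≡ m ℤ.+ c ℤ.* + t → m %ℕ t ≡ w % t
%ℕ-unique t m w c eq = remainder (m /ℕ t ℤ.+ c) (begin
  + w                                                  ≡⟨ eq ⟩
  m ℤ.+ c ℤ.* + t                                      ≡⟨ ≡.cong (ℤ._+ c ℤ.* + t) (a≡a%ℕn+[a/ℕn]*n m t) ⟩
  + r ℤ.+ (m /ℕ t) ℤ.* + t ℤ.+ c ℤ.* + t               ≡⟨ regroup (+ r) (m /ℕ t) c (+ t) ⟩
  + r ℤ.+ (m /ℕ t ℤ.+ c) ℤ.* + t                       ∎)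
  where
  open ≡.≡-Reasoning
  r = m %ℕ t
  regroup : ∀ r q c t → r ℤ.+ q ℤ.* t ℤ.+ c ℤ.* t ≡ r ℤ.+ (q ℤ.+ c) ℤ.* t
  regroup = solve-ℤ
  remainder : ∀ q → + w ≡ + r ℤ.+ q ℤ.* + t → r ≡ w % t
  remainder (+ q) eq = ≡.sym (≡.trans
    (≡.cong (_% t) (ℤ.+-injective (≡.trans eq (≡.cong (ℤ._+_ (+ r)) (≡.sym (ℤ.pos-* q t))))))
    (≡.trans ([m+kn]%n≡m%n r q t) (m<n⇒m%n≡m (n%ℕd<d m t))))
  -- A negative quotient would give r = w + (q+1) t ≥ t, against the bound on the remainder r.
  remainder -[1+ q ] eq = contradiction (n%ℕd<d m t)
    (ℕ.≤⇒≯ (ℕ.≤-trans (ℕ.m≤n*m t (suc q)) (ℕ.≤-trans (ℕ.m≤n+m (suc q * t) w) (ℕ.≤-reflexive (ℤ.+-injective (begin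
      + (w + suc q * t)                                ≡⟨ ≡.cong (ℤ._+_ (+ w)) (ℤ.pos-* (suc q) t) ⟩
      + w ℤ.+ + suc q ℤ.* + t                          ≡⟨ ≡.cong (ℤ._+ + suc q ℤ.* + t) eq ⟩
      + r ℤ.+ -[1+ q ] ℤ.* + t ℤ.+ + suc q ℤ.* + t     ≡⟨ cancel (+ r) (+ suc q) (+ t) ⟩
      + r                                              ∎))))))
    where
    cancel : ∀ r q t → r ℤ.+ (ℤ.- q) ℤ.* t ℤ.+ q ℤ.* t ≡ r
    cancel = solve-ℤ

partLength : ∀ {s} → Vec (List ℕ) s → ℕ → ℕ
partLength v p = length (nth (toList v) p)

linearRank-∑ : ∀ {s} p (v : Vec (List ℕ) s) → + linearRank p v ≡ Z∑.∑ s (λ k → + (p + k) ℤ.* + partLength v k)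
linearRank-∑ p []      = ≡.refl
linearRank-∑ {suc s} p (π ∷ v) = ≡.trans (ℤ.pos-+ (p * length π) (linearRank (suc p) v)) (≡.cong₂ ℤ._+_
  (≡.trans (ℤ.pos-* p (length π)) (≡.cong (λ k → + k ℤ.* + length π) (≡.sym (ℕ.+-identityʳ p))))
  (≡.trans (linearRank-∑ (suc p) v)
           (Z∑.∑-cong s (λ k → ≡.cong (λ e → + e ℤ.* + partLength v k) (≡.sym (ℕ.+-suc p k))))))

sumℤ-applyUpTo : ∀ (f : ℕ → ℤ) g n → sumℤ (map f (applyUpTo g n)) ≡ Z∑.∑ n (λ k → f (g k))
sumℤ-applyUpTo f g zero    = ≡.refl
sumℤ-applyUpTo f g (suc n) = ≡.cong (ℤ._+_ (f (g 0))) (sumℤ-applyUpTo f (λ k → g (suc k)) n)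

∑-fold-in-half : ∀ h (g : ℕ → ℤ) → Z∑.∑ (h * 2) g ≡ Z∑.∑ h (λ i → g i ℤ.+ g (h * 2 ∸ suc i))
∑-fold-in-half h g = begin
  Z∑.∑ (h * 2) g
    ≡⟨ ≡.cong (λ n → Z∑.∑ n g) (double h) ⟩
  Z∑.∑ (h + h) g
    ≡⟨ Z∑.∑-split h h g ⟩
  Z∑.∑ h g ℤ.+ Z∑.∑ h (λ i → g (h + i))
    ≡⟨ ≡.cong (ℤ._+_ (Z∑.∑ h g)) (Z∑.∑-reverse h (λ i → g (h + i))) ⟨
  Z∑.∑ h g ℤ.+ Z∑.∑ h (λ i → g (h + (h ∸ suc i)))
    ≡⟨ Z∑.∑-+ h g (λ i → g (h + (h ∸ suc i))) ⟨
  Z∑.∑ h (λ i → g i ℤ.+ g (h + (h ∸ suc i)))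
    ≡⟨ Z∑.∑-cong< h (λ i i<h → ≡.cong (λ p → g i ℤ.+ g p)
         (≡.trans (≡.sym (ℕ.+-∸-assoc h i<h)) (≡.cong (_∸ suc i) (≡.sym (double h))))) ⟩
  Z∑.∑ h (λ i → g i ℤ.+ g (h * 2 ∸ suc i)) ∎
  where
  open ≡.≡-Reasoning
  double : ∀ h → h * 2 ≡ h + h
  double = solve-∀

-- The colours k and s + 1 - k are paired. The second has linear weight (s+1) - k where the
-- multirank has -k, so the two ranks differ by (s+1) `c`, with `c` the number of parts in the
-- second half of the colours.
multirank≡linearRank : ∀ h {s} → s ≡ h * 2 → (v : Vec (List ℕ) s) → multirank v %ℕ suc s ≡ linearRank 1 v % suc s
multirank≡linearRank h {s} ≡.refl v = %ℕ-unique (suc s) (multirank v) (linearRank 1 v) c (begin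
  + linearRank 1 v
    ≡⟨ linearRank-∑ 1 v ⟩
  Z∑.∑ s (λ k → + suc k ℤ.* a k)
    ≡⟨ ∑-fold-in-half h (λ k → + suc k ℤ.* a k) ⟩
  Z∑.∑ h (λ i → + suc i ℤ.* a i ℤ.+ + suc (s ∸ suc i) ℤ.* a (s ∸ suc i))
    ≡⟨ Z∑.∑-cong< h pair ⟩
  Z∑.∑ h (λ i → term i ℤ.+ a (s ∸ suc i) ℤ.* + suc s)
    ≡⟨ Z∑.∑-+ h term (λ i → a (s ∸ suc i) ℤ.* + suc s) ⟩
  Z∑.∑ h term ℤ.+ Z∑.∑ h (λ i → a (s ∸ suc i) ℤ.* + suc s)
    ≡⟨ ≡.cong₂ ℤ._+_ multirank-∑ (Z∑.∑-distribʳ (+ suc s) h (λ i → a (s ∸ suc i))) ⟨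
  multirank v ℤ.+ c ℤ.* + suc s ∎)
  where
  open ≡.≡-Reasoning
  a : ℕ → ℤ
  a k = + partLength v k
  c = Z∑.∑ h (λ i → a (s ∸ suc i))
  term : ℕ → ℤ
  term i = + suc i ℤ.* (a i ℤ.- + ℓat v ((s + 1) ∸ suc i))
  multirank-∑ : multirank v ≡ Z∑.∑ h term
  multirank-∑ = ≡.trans (≡.cong (λ n → sumℤ (map term (upTo n))) (m*n/n≡m h 2)) (sumℤ-applyUpTo term (λ k → k) h)
  mirror : ∀ i → ℓat v ((s + 1) ∸ suc i) ≡ partLength v (s ∸ suc i)
  mirror i = ≡.cong (partLength v) (≡.trans (≡.cong (λ n → n ∸ suc i ∸ 1) (ℕ.+-comm s 1))
    (≡.trans (ℕ.∸-+-assoc s i 1) (≡.cong (s ∸_) (ℕ.+-comm i 1))))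
  regroup : ∀ i j x y → i ℤ.* x ℤ.+ j ℤ.* y ≡ i ℤ.* (x ℤ.- y) ℤ.+ y ℤ.* (j ℤ.+ i)
  regroup = solve-ℤ
  pair : ∀ i → i < h → + suc i ℤ.* a i ℤ.+ + suc (s ∸ suc i) ℤ.* a (s ∸ suc i) ≡ term i ℤ.+ a (s ∸ suc i) ℤ.* + suc s
  pair i i<h = ≡.trans (regroup (+ suc i) (+ suc (s ∸ suc i)) (a i) (a (s ∸ suc i))) (≡.cong₂ ℤ._+_
    (≡.cong (λ l → + suc i ℤ.* (a i ℤ.- + l)) (≡.sym (mirror i)))
    (≡.cong (λ n → a (s ∸ suc i) ℤ.* + suc n) (ℕ.m∸n+n≡m (ℕ.≤-trans i<h (ℕ.m≤m*n h 2)))))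

odd-prime : ∀ {s} → Prime (suc s) → suc s ≢ 2 → s ≡ s / 2 * 2
odd-prime {s} t-prime t≢2 with s % 2 in eq | m%n<n s 2
... | 0 | _ = ≡.trans (m≡m%n+[m/n]*n s 2) (≡.cong (_+ s / 2 * 2) eq)
... | 1 | _ = contradiction 2∣t 2∤t
  where
  2∣t : 2 ∣ suc s
  2∣t = divides (suc (s / 2)) (≡.cong suc (≡.trans (m≡m%n+[m/n]*n s 2) (≡.cong (_+ s / 2 * 2) eq)))
  2∤t : ¬ (2 ∣ suc s)
  2∤t 2∣t with prime⇒irreducible t-prime 2∣t
  ... | inj₁ ()
  ... | inj₂ 2≡t = t≢2 (≡.sym 2≡t)
... | suc (suc _) | s≤s (s≤s ())

theorem2p4 : (t : ℕ) → .{{_ : NonZero t}} → Prime t → t ≢ 2 →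
    (n : ℕ) → QuadNonResidue (8 * n + 1) t →
    ((i : ℕ) → i < t → t * Nhat (t ∸ 1) i t n ≡ phat (t ∸ 1) n)
    × (t ∣ phat (t ∸ 1) n)
theorem2p4 t@(suc s) t-prime t≢2 n nonresidue = equal , divides (Nhat s 0 t n)
    (≡.trans (≡.sym (equal 0 (s≤s z≤n))) (ℕ.*-comm t (Nhat s 0 t n)))
  where
  open Cyclotomic t
  open Equidistribution t
  vanishes : RootOfUnity.coloredSeries ring n t t-prime 𝕫 s 1 n ≈ 𝟘
  vanishes = RootOfUnity.coloredSeries-vanishes ring n t t-prime 𝕫 𝕫^t≈1 ∑𝕫≈0 torsion-free s ≡.refl nonresidue
  equal : (i : ℕ) → i < t → t * Nhat s i t n ≡ phat s n
  equal i i<t = equidistributed (linearRank 1) (λ v → does (multirank v %ℕ t ≟ i % t)) i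
    (λ v → ≡.cong₂ (λ r j → does (r ≟ j)) (multirank≡linearRank (s / 2) (odd-prime t-prime t≢2) v) (m<n⇒m%n≡m i<t))
    i<t (coloredPods s n) vanishes
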